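{- Let $G$ be a simple planar graph that is rationally $K_3$-decomposable. Then $G$ has a rational $K_3$-decomposition in which every triangle receives a weight in $\{0,1,\tfrac12\}$.
   Context: A rational $K_3$-decomposition of a graph $G$ is an assignment of nonnegative rational weights to the triangles (copies of $K_3$) of $G$ such that for every edge $e$ of $G$, the sum of the weights of the triangles containing $e$ equals $1$. $G$ is rationally $K_3$-decomposable if it admits such an assignment. -}

module Defs where

open import Data.Bool using (Bool; true; false; _∧_; _∨_; not; if_then_else_)
open import Data.Nat using (ℕ; zero; suc; _+_; _*_; _≤ᵇ_; _<ᵇ_; _≡ᵇ_)
open import Data.Fin using (Fin; toℕ)
open import Data.Fin.Permutation using (Permutation′; _⟨$⟩ʳ_)
open import Data.Product using (Σ; ∃; _×_; _,_)
open import Data.Sum using (_⊎_)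
open import Data.Rational using (ℚ; 0ℚ; 1ℚ; ½; _≤_; _+_)
open import Relation.Binary.PropositionalEquality using (_≡_)

record SimpleGraph (n : ℕ) : Set where
  field
    adj   : Fin n → Fin n → Bool
    sym   : ∀ u v → adj u v ≡ adj v u
    irrefl : ∀ u → adj u u ≡ false

open SimpleGraph public

anyF : {n : ℕ} → (Fin n → Bool) → Bool
anyF {zero}  p = false
anyF {suc n} p = p Data.Fin.zero ∨ anyF {n} (λ i → p (Data.Fin.suc i))

allF : {n : ℕ} → (Fin n → Bool) → Bool
allF p = not (anyF (λ i → not (p i)))

countF : {n : ℕ} → (Fin n → Bool) → ℕ
countF {zero}  p = 0
countF {suc n} p = (if p Data.Fin.zero then 1 else 0) Data.Nat.+ countF {n} (λ i → p (Data.Fin.suc i))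

sumℚ : {n : ℕ} → (Fin n → ℚ) → ℚ
sumℚ {zero}  f = 0ℚ
sumℚ {suc n} f = f Data.Fin.zero Data.Rational.+ sumℚ {n} (λ i → f (Data.Fin.suc i))

eqF : {n : ℕ} → Fin n → Fin n → Bool
eqF i j = toℕ i ≡ᵇ toℕ j

iter : {A : Set} → (A → A) → ℕ → A → A
iter f zero    x = x
iter f (suc k) x = f (iter f k x)

-- number of orbits (cycles) of a permutation-like map f on Fin m:
-- count the elements that are the least element of their orbit
orbitCount : {m : ℕ} → (Fin m → Fin m) → ℕ
orbitCount {m} f =
  countF (λ x → allF {m} (λ k → toℕ x ≤ᵇ toℕ (iter f (toℕ k) x)))

reach : {n : ℕ} → SimpleGraph n → ℕ → Fin n → Fin n → Bool
reach G zero    u v = eqF u v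
reach G (suc t) u v = reach G t u v ∨ anyF (λ w → reach G t u w ∧ adj G w v)

-- number of connected components of G containing at least one edge
-- (counted by their least vertex)
nontrivialComponents : {n : ℕ} → SimpleGraph n → ℕ
nontrivialComponents {n} G =
  countF (λ u → anyF (adj G u)
                ∧ not (anyF (λ v → (toℕ v <ᵇ toℕ u) ∧ reach G n v u)))

-- Planarity, via combinatorial embeddings (rotation systems).
-- Darts are Fin m; tail d is the vertex at which d starts, α reverses a
-- dart, σ is the rotation around the tail vertex.  The darts correspond
-- bijectively to the ordered pairs (u , v) with u ~ v.

record RotationSystem {n : ℕ} (G : SimpleGraph n) : Set where
  field
    m      : ℕ
    tail   : Fin m → Fin n
    α      : Permutation′ m
    σ      : Permutation′ m
  head : Fin m → Fin n
  head d = tail (α ⟨$⟩ʳ d)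
  field
    α-invol    : ∀ d → α ⟨$⟩ʳ (α ⟨$⟩ʳ d) ≡ d
    dart-edge  : ∀ d → adj G (tail d) (head d) ≡ true
    dart-inj   : ∀ d d' → tail d ≡ tail d' → head d ≡ head d' → d ≡ d'
    dart-surj  : ∀ u v → adj G u v ≡ true → ∃ λ d → tail d ≡ u × head d ≡ v
    σ-tail     : ∀ d → tail (σ ⟨$⟩ʳ d) ≡ tail d
    σ-cyclic   : ∀ d d' → tail d ≡ tail d' → ∃ λ k → iter (σ ⟨$⟩ʳ_) k d ≡ d'
  -- vertices of positive degree = σ-orbits; faces = orbits of σ ∘ α
  vertexCount : ℕ
  vertexCount = orbitCount (σ ⟨$⟩ʳ_)
  faceCount : ℕ
  faceCount = orbitCount (λ d → σ ⟨$⟩ʳ (α ⟨$⟩ʳ d))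

open RotationSystem public

-- G is planar iff it has a rotation system of Euler genus 0, i.e. each
-- nontrivial component satisfies V - E + F = 2.  With E = m / 2, summed
-- over the c nontrivial components:  2 (V + F) = m + 4 c.
Planar : {n : ℕ} → SimpleGraph n → Set
Planar G = Σ (RotationSystem G) λ R →
  2 * (vertexCount R Data.Nat.+ faceCount R)
    ≡ m R Data.Nat.+ 4 * nontrivialComponents G

-- Rational K3-decompositions.
-- A weighting of triangles is a function w on triples of vertices that is
-- invariant under permuting its arguments; only its values on triangles
-- (pairwise adjacent triples) matter.

IsTriangle : {n : ℕ} → SimpleGraph n → Fin n → Fin n → Fin n → Set
IsTriangle G a b c = adj G a b ≡ true × adj G b c ≡ true × adj G a c ≡ true

record RationalK3Decomposition {n : ℕ} (G : SimpleGraph n) : Set where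
  field
    w        : Fin n → Fin n → Fin n → ℚ
    w-swap₁₂ : ∀ a b c → w a b c ≡ w b a c
    w-swap₂₃ : ∀ a b c → w a b c ≡ w a c b
    w-nonneg : ∀ a b c → IsTriangle G a b c → 0ℚ ≤ w a b c
    w-edge   : ∀ u v → adj G u v ≡ true →
               sumℚ (λ x → if adj G u x ∧ adj G v x then w u v x else 0ℚ) ≡ 1ℚ

open RationalK3Decomposition public

RationallyK3Decomposable : {n : ℕ} → SimpleGraph n → Set
RationallyK3Decomposable G = RationalK3Decomposition G

-- Proof idea.  By Euler's formula and a dimension count, every triangle bounds a region: there is
-- a function on faces, zero on a chosen outer face of each component, whose jump across edges
-- is the flow around the triangle.  Its square is a multiple of it, so it is the indicator of an
-- inside.  Two triangles are nested or have disjoint insides.  Take the triangles by increasing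
-- size of the inside, and let Y d be the weight put on the edge of the dart d from the side of d
-- by the triangles taken so far.  When the turn of T comes, the edges strictly inside T carry
-- total weight 1.  Cross these edges between the faces that remain after everything inside
-- earlier triangles is merged: the value Y modulo 1 changes to its negative, so the three
-- inner sides of T have values ±y, and as the earlier triangles have three sides each, a
-- count modulo 3 shows that the three values are equal.  Hence rounding every Y to 0, ½ or 1
-- increases it by the same amount on the three sides of T, and that amount is the new weight
-- of T.  The rounded values on the two sides of an edge add up to 1.
module Submission where

open import Defs renaming (sym to adj-sym; sumℚ to sum)
open import Data.Bool using (Bool; true; false; _∧_; _∨_; not; if_then_else_; T)
import Data.Bool.Properties as 𝔹
open import Data.Empty using (⊥; ⊥-elim)
open import Data.Fin using (Fin; zero; suc; toℕ; fromℕ<; punchIn; punchOut)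
import Data.Fin as Fin
import Data.Fin.Properties as Fin
open import Data.Fin.Permutation using (Permutation′; _⟨$⟩ʳ_; _⟨$⟩ˡ_; inverseˡ)
import Data.List
open import Data.List using (List; []; _∷_; length; _++_)
import Data.List.Properties as List
open import Data.List.Relation.Unary.All using (All; []; _∷_)
import Data.List.Relation.Unary.All as All
import Data.List.Relation.Unary.All.Properties as All
open import Data.Maybe using (just; nothing)
open import Data.Nat as ℕ using (ℕ; zero; suc; z≤n; s≤s)
import Data.Nat.DivMod as ℕ
import Data.Nat.Properties as ℕ
open import Data.Nat.Induction using (<-wellFounded)
open import Data.Nat.Tactic.RingSolver using () renaming (solve-∀ to solveℕ)
open import Data.Product using (Σ; ∃; _×_; _,_; proj₁; proj₂)
open import Data.Rational using (ℚ; 0ℚ; 1ℚ; ½; _≤_; _+_; _*_; -_; _-_; 1/_)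
import Data.Rational as ℚ
import Data.Rational.Properties as ℚ
open import Data.Sum using (_⊎_; inj₁; inj₂; [_,_]′)
open import Data.Unit using (tt)
open import Function using (_∘_; id; const)
open import Induction.WellFounded using (Acc; acc)
open import Level using (0ℓ)
import Algebra.Properties.CommutativeMonoid.Sum ℚ.+-0-commutativeMonoid as StdSum
import Algebra.Properties.CommutativeMonoid.Sum ℕ.+-0-commutativeMonoid as StdSumℕ
open import Relation.Binary.Definitions using (tri<; tri≈; tri>)
open import Relation.Binary.PropositionalEquality using (_≡_; _≢_; refl; sym; trans; cong; cong₂; subst; subst₂; module ≡-Reasoning)
open import Relation.Nullary using (¬_; Dec; yes; no; does)
open import Relation.Nullary.Decidable using (¬?; _⊎-dec_; dec-true; dec-false)
open import Tactic.RingSolver.Core.AlmostCommutativeRing using (AlmostCommutativeRing; fromCommutativeRing)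
open import Tactic.RingSolver using (solve-∀)

-- No topology is used; one minimality statement replaces it. Since potentials with jumps only on a
-- triangle are multiples of one of them, a set of faces that avoids the outer faces and whose
-- border lies on T is empty or the whole inside of T. This yields both the alternative between
-- nested and disjoint triangles and the fact that only the values ±y occur inside T. In the count
-- modulo 3, a visible dart inside T counts 1 if its value is y and -1 if it is -y. The two darts of
-- an edge strictly inside T cancel, so only the three inner sides of T remain. Faces of the graph
-- may have any number of sides: outside all treated triangles their value is 0, which is its own
-- negative, so they count nothing. A merged triangle shows three darts of equal value, so the count
-- stays divisible by three. The obstacle is that 0 and 1 agree modulo 1 but round differently. No
-- positive weight can be added at 1, since an edge carries total weight 1, and a zero weight
-- changes no rounded value.

ringℚ : AlmostCommutativeRing 0ℓ 0ℓ
ringℚ = fromCommutativeRing ℚ.+-*-commutativeRing zero?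
  where
  zero? : ∀ x → _
  zero? x with 0ℚ ℚ.≟ x
  ... | yes p = just p
  ... | no _  = nothing

-- Finite sums of rationals

sum-std : ∀ {n} (f : Fin n → ℚ) → sum f ≡ StdSum.sum f
sum-std {zero}  f = refl
sum-std {suc n} f = cong (f zero +_) (sum-std (f ∘ suc))

sum-permute : ∀ {n} (f : Fin n → ℚ) (π : Permutation′ n) → sum (λ i → f (π ⟨$⟩ʳ i)) ≡ sum f
sum-permute f π = trans (sum-std (λ i → f (π ⟨$⟩ʳ i))) (sym (trans (sum-std f) (StdSum.sum-permute f π)))

sum-cong : ∀ {n} {f g : Fin n → ℚ} → (∀ i → f i ≡ g i) → sum f ≡ sum g
sum-cong {zero}  h = refl
sum-cong {suc n} h = cong₂ _+_ (h zero) (sum-cong (h ∘ suc))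

*-distribˡ-sum : ∀ {n} c (f : Fin n → ℚ) → c * sum f ≡ sum (λ i → c * f i)
*-distribˡ-sum {zero}  c f = ℚ.*-zeroʳ c
*-distribˡ-sum {suc n} c f = trans (ℚ.*-distribˡ-+ c (f zero) _) (cong (c * f zero +_) (*-distribˡ-sum c (f ∘ suc)))

sum-+ : ∀ {n} (f g : Fin n → ℚ) → sum (λ i → f i + g i) ≡ sum f + sum g
sum-+ {zero}  f g = refl
sum-+ {suc n} f g = trans (cong ((f zero + g zero) +_) (sum-+ (f ∘ suc) (g ∘ suc)))
                          (lem (f zero) (g zero) (sum (f ∘ suc)) (sum (g ∘ suc)))
  where
  lem : ∀ a b c d → (a + b) + (c + d) ≡ (a + c) + (b + d)
  lem = solve-∀ ringℚ

sum-zero : ∀ {n} (f : Fin n → ℚ) → (∀ i → f i ≡ 0ℚ) → sum f ≡ 0ℚ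
sum-zero {zero}  f h = refl
sum-zero {suc n} f h = cong₂ _+_ (h zero) (sum-zero (f ∘ suc) (h ∘ suc))

sum-- : ∀ {n} (f g : Fin n → ℚ) → sum (λ i → f i - g i) ≡ sum f - sum g
sum-- {zero}  f g = refl
sum-- {suc n} f g = trans (cong ((f zero - g zero) +_) (sum-- (f ∘ suc) (g ∘ suc)))
                          (lem (f zero) (g zero) (sum (f ∘ suc)) (sum (g ∘ suc)))
  where
  lem : ∀ a b c d → (a - b) + (c - d) ≡ (a + c) - (b + d)
  lem = solve-∀ ringℚ

sum-single : ∀ {n} (f : Fin n → ℚ) j → (∀ i → i ≢ j → f i ≡ 0ℚ) → sum f ≡ f j
sum-single {suc n} f zero h =
  trans (cong (f zero +_) (sum-zero (f ∘ suc) (λ i → h (suc i) λ ()))) (ℚ.+-identityʳ _)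
sum-single {suc n} f (suc j) h =
  trans (cong₂ _+_ (h zero λ ())
                   (sum-single (f ∘ suc) j (λ i i≢j → h (suc i) (i≢j ∘ Fin.suc-injective))))
        (ℚ.+-identityˡ _)

+-nonneg : ∀ {a b} → 0ℚ ≤ a → 0ℚ ≤ b → 0ℚ ≤ a + b
+-nonneg p q = ℚ.+-mono-≤ p q

a≤a+b : ∀ {a b} → 0ℚ ≤ b → a ≤ a + b
a≤a+b {a} {b} 0≤b = subst (_≤ a + b) (ℚ.+-identityʳ a) (ℚ.+-monoʳ-≤ a 0≤b)

b≤a+b : ∀ {a b} → 0ℚ ≤ a → b ≤ a + b
b≤a+b {a} {b} 0≤a = subst (_≤ a + b) (ℚ.+-identityˡ b) (ℚ.+-monoˡ-≤ b 0≤a)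

sum-nonneg : ∀ {n} (f : Fin n → ℚ) → (∀ i → 0ℚ ≤ f i) → 0ℚ ≤ sum f
sum-nonneg {zero}  f h = ℚ.≤-refl
sum-nonneg {suc n} f h = +-nonneg (h zero) (sum-nonneg (f ∘ suc) (h ∘ suc))

sum-nonneg-zero : ∀ {n} (f : Fin n → ℚ) → (∀ i → 0ℚ ≤ f i) → sum f ≡ 0ℚ → ∀ i → f i ≡ 0ℚ
sum-nonneg-zero {suc n} f h eq zero =
  ℚ.≤-antisym (subst (f zero ≤_) eq (a≤a+b (sum-nonneg (f ∘ suc) (h ∘ suc)))) (h zero)
sum-nonneg-zero {suc n} f h eq (suc i) =
  sum-nonneg-zero (f ∘ suc) (h ∘ suc)
    (ℚ.≤-antisym (subst (sum (f ∘ suc) ≤_) eq (b≤a+b (h zero))) (sum-nonneg (f ∘ suc) (h ∘ suc))) i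

minus-zero : ∀ {a b} → a - b ≡ 0ℚ → a ≡ b
minus-zero {a} {b} e = trans (l a b) (trans (cong (_+ b) e) (ℚ.+-identityˡ b))
  where
  l : ∀ a b → a ≡ (a - b) + b
  l = solve-∀ ringℚ

*-zero-cases : ∀ a b → a * b ≡ 0ℚ → a ≡ 0ℚ ⊎ b ≡ 0ℚ
*-zero-cases a b ab≡0 with a ℚ.≟ 0ℚ
... | yes a≡0 = inj₁ a≡0
... | no a≢0 = inj₂ (trans (lem a (1/ a) b (ℚ.*-inverseˡ a)) (trans (cong (1/ a *_) ab≡0) (ℚ.*-zeroʳ (1/ a))))
  where
  instance _ = ℚ.≢-nonZero a≢0
  lem : ∀ a c b → c * a ≡ 1ℚ → b ≡ c * (a * b)
  lem a c b e = trans (sym (ℚ.*-identityˡ b)) (trans (cong (_* b) (sym e)) (ℚ.*-assoc c a b))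

square-nonneg : ∀ a → 0ℚ ≤ a * a
square-nonneg a with ℚ.≤-total 0ℚ a
... | inj₁ 0≤a = subst (_≤ a * a) (ℚ.*-zeroˡ a) (ℚ.*-monoʳ-≤-nonNeg a {{ℚ.nonNegative 0≤a}} 0≤a)
... | inj₂ a≤0 = subst (_≤ a * a) (ℚ.*-zeroˡ a) (ℚ.*-monoʳ-≤-nonPos a {{ℚ.nonPositive a≤0}} a≤0)

square-zero : ∀ a → a * a ≡ 0ℚ → a ≡ 0ℚ
square-zero a h = [ id , id ]′ (*-zero-cases a a h)

-- Homogeneous linear systems

-- Gaussian elimination on the first unknown.
kernel-vector : ∀ k {N} (A : Fin k → Fin N → ℚ) → k ℕ.< N →
  Σ (Fin N → ℚ) λ v → (∃ λ j → v j ≢ 0ℚ) × (∀ i → sum (λ j → A i j * v j) ≡ 0ℚ)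
kernel-vector zero {suc N} A _ = const 1ℚ , (zero , λ ()) , λ ()
kernel-vector (suc k) {suc N} A (s≤s k<N) with Fin.any? (λ i → ¬? (A i zero ℚ.≟ 0ℚ))
... | no none = v , (zero , λ ()) , row
  where
  v : Fin (suc N) → ℚ
  v zero    = 1ℚ
  v (suc _) = 0ℚ
  row : ∀ i → sum (λ j → A i j * v j) ≡ 0ℚ
  row i with A i zero ℚ.≟ 0ℚ
  ... | no a≢0 = ⊥-elim (none (i , a≢0))
  ... | yes a≡0 = sum-zero (λ j → A i j * v j) λ { zero → trans (cong (_* 1ℚ) a≡0) (ℚ.*-zeroˡ 1ℚ) ; (suc j) → ℚ.*-zeroʳ (A i (suc j)) }
... | yes (r , p≢0) = v , (suc (proj₁ nz) , proj₂ nz) , row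
  where
  p = A r zero
  instance _ = ℚ.≢-nonZero p≢0
  c : Fin k → ℚ
  c i = A (punchIn r i) zero * 1/ p
  B : Fin k → Fin N → ℚ
  B i j = A (punchIn r i) (suc j) - c i * A r (suc j)
  rec = kernel-vector k B k<N
  v′ = proj₁ rec
  nz = proj₁ (proj₂ rec)
  S : Fin (suc k) → ℚ
  S i = sum (λ j → A i (suc j) * v′ j)
  v : Fin (suc N) → ℚ
  v zero    = - (1/ p * S r)
  v (suc j) = v′ j
  pivot : ∀ p q s → p * q ≡ 1ℚ → p * (- (q * s)) + s ≡ 0ℚ
  pivot p q s e = trans (l p q s) (trans (cong (λ x → s - x * s) e) (l′ s))
    where
    l : ∀ p q s → p * (- (q * s)) + s ≡ s - (p * q) * s
    l = solve-∀ ringℚ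
    l′ : ∀ s → s - 1ℚ * s ≡ 0ℚ
    l′ = solve-∀ ringℚ
  other : ∀ i → S (punchIn r i) ≡ c i * S r
  other i = trans (l (S (punchIn r i)) (c i * S r)) (trans (cong (_+ c i * S r) (trans (sym expand) (proj₂ (proj₂ rec) i))) (ℚ.+-identityˡ _))
    where
    l : ∀ a b → a ≡ (a - b) + b
    l = solve-∀ ringℚ
    d : ∀ a c b x → (a - c * b) * x ≡ a * x - c * (b * x)
    d = solve-∀ ringℚ
    expand : sum (λ j → B i j * v′ j) ≡ S (punchIn r i) - c i * S r
    expand = trans (sum-cong λ j → d (A (punchIn r i) (suc j)) (c i) (A r (suc j)) (v′ j))
      (trans (sum-- (λ j → A (punchIn r i) (suc j) * v′ j) (λ j → c i * (A r (suc j) * v′ j)))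
             (cong (λ x → S (punchIn r i) - x) (sym (*-distribˡ-sum (c i) (λ j → A r (suc j) * v′ j)))))
  row : ∀ i → A i zero * v zero + S i ≡ 0ℚ
  row i with r Fin.≟ i
  ... | yes refl = pivot p (1/ p) (S r) (ℚ.*-inverseʳ p)
  ... | no r≢i = subst (λ i → A i zero * v zero + S i ≡ 0ℚ) (Fin.punchIn-punchOut r≢i)
      (trans (cong (A (punchIn r i′) zero * v zero +_) (other i′)) (l (A (punchIn r i′) zero) (1/ p) (S r)))
    where
    i′ = punchOut r≢i
    l : ∀ a q s → a * (- (q * s)) + (a * q) * s ≡ 0ℚ
    l = solve-∀ ringℚ

-- A syntax for linear forms: the equations are written as expressions, and the coefficient matrix
-- required by the elimination is computed from them.
data Linear (N : ℕ) : Set where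
  var : Fin N → Linear N
  _⊖_ : Linear N → Linear N → Linear N
  _⊛_ : ℚ → Linear N → Linear N

infixl 6 _⊖_
infixl 7 _⊛_

⟦_⟧ : ∀ {N} → Linear N → (Fin N → ℚ) → ℚ
⟦ var i ⟧ v = v i
⟦ e ⊖ e′ ⟧ v = ⟦ e ⟧ v - ⟦ e′ ⟧ v
⟦ c ⊛ e ⟧ v = c * ⟦ e ⟧ v

coefficient : ∀ {N} → Linear N → Fin N → ℚ
coefficient (var i) j = if does (i Fin.≟ j) then 1ℚ else 0ℚ
coefficient (e ⊖ e′) j = coefficient e j - coefficient e′ j
coefficient (c ⊛ e) j = c * coefficient e j

sum-coefficient : ∀ {N} (e : Linear N) v → sum (λ j → coefficient e j * v j) ≡ ⟦ e ⟧ v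
sum-coefficient (var i) v = trans (sum-single _ i off) on
  where
  off : ∀ j → j ≢ i → coefficient (var i) j * v j ≡ 0ℚ
  off j j≢i with i Fin.≟ j
  ... | yes refl = ⊥-elim (j≢i refl)
  ... | no _ = ℚ.*-zeroˡ (v j)
  on : coefficient (var i) i * v i ≡ v i
  on with i Fin.≟ i
  ... | yes _ = ℚ.*-identityˡ (v i)
  ... | no i≢i = ⊥-elim (i≢i refl)
sum-coefficient (e ⊖ e′) v = trans (sum-cong λ j → d (coefficient e j) (coefficient e′ j) (v j))
    (trans (sum-- (λ j → coefficient e j * v j) (λ j → coefficient e′ j * v j)) (cong₂ _-_ (sum-coefficient e v) (sum-coefficient e′ v)))
  where
  d : ∀ a b x → (a - b) * x ≡ a * x - b * x
  d = solve-∀ ringℚ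
sum-coefficient (c ⊛ e) v = trans (sum-cong λ j → ℚ.*-assoc c (coefficient e j) (v j))
    (trans (sym (*-distribˡ-sum c (λ j → coefficient e j * v j))) (cong (c *_) (sum-coefficient e v)))

lookup⇒All : ∀ {A : Set} {P : A → Set} (xs : List A) → (∀ i → P (Data.List.lookup xs i)) → All P xs
lookup⇒All []       h = []
lookup⇒All (x ∷ xs) h = h zero ∷ lookup⇒All xs (h ∘ suc)

abstract
  nontrivial-solution : ∀ {N} (es : List (Linear N)) → length es ℕ.< N →
    Σ (Fin N → ℚ) λ v → (∃ λ j → v j ≢ 0ℚ) × All (λ e → ⟦ e ⟧ v ≡ 0ℚ) es
  nontrivial-solution es lt with kernel-vector (length es) (λ i → coefficient (Data.List.lookup es i)) lt
  ... | v , nz , sol = v , nz , lookup⇒All es λ i → trans (sym (sum-coefficient (Data.List.lookup es i) v)) (sol i)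

-- Counting and orbits of permutations

T⇒true : ∀ {b} → T b → b ≡ true
T⇒true {true} _ = refl

true⇒T : ∀ {b} → b ≡ true → T b
true⇒T refl = tt

not-true : ∀ {b} → not b ≡ true → b ≡ false
not-true {false} _ = refl

not-false : ∀ {b} → not b ≡ false → b ≡ true
not-false {true} _ = refl

true≢false : ∀ {b} → b ≡ true → b ≡ false → ⊥
true≢false refl ()

by-cases : ∀ {P : Set} b → (b ≡ true → P) → (b ≡ false → P) → P
by-cases true  t f = t refl
by-cases false t f = f refl

anyF-true : ∀ {n} (p : Fin n → Bool) → anyF p ≡ true → ∃ λ i → p i ≡ true
anyF-true {suc n} p h with p zero in eq
... | true  = zero , eq
... | false = let i , pi = anyF-true (p ∘ suc) h in suc i , pi

anyF-false : ∀ {n} (p : Fin n → Bool) → anyF p ≡ false → ∀ i → p i ≡ false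
anyF-false {suc n} p h i with p zero in eq
anyF-false {suc n} p h zero    | false = eq
anyF-false {suc n} p h (suc i) | false = anyF-false (p ∘ suc) h i

anyF-intro : ∀ {n} (p : Fin n → Bool) i → p i ≡ true → anyF p ≡ true
anyF-intro p i pi with anyF p in eq
... | true  = refl
... | false = ⊥-elim (true≢false pi (anyF-false p eq i))

allF-true : ∀ {n} (p : Fin n → Bool) → allF p ≡ true → ∀ i → p i ≡ true
allF-true p h i = not-false (anyF-false (λ i → not (p i)) (not-true h) i)

allF-false : ∀ {n} (p : Fin n → Bool) → allF p ≡ false → ∃ λ i → p i ≡ false
allF-false p h = let i , e = anyF-true (λ i → not (p i)) (not-false h) in i , not-true e

countF-cong : ∀ {n} {p q : Fin n → Bool} → (∀ i → p i ≡ q i) → countF p ≡ countF q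
countF-cong {zero}  h = refl
countF-cong {suc n} h = cong₂ (λ a b → (if a then 1 else 0) ℕ.+ b) (h zero) (countF-cong (h ∘ suc))

countF-std : ∀ {n} (p : Fin n → Bool) → countF p ≡ StdSumℕ.sum (λ i → if p i then 1 else 0)
countF-std {zero}  p = refl
countF-std {suc n} p = cong ((if p zero then 1 else 0) ℕ.+_) (countF-std (p ∘ suc))

countF-permute : ∀ {n} (p : Fin n → Bool) (π : Permutation′ n) → countF (λ i → p (π ⟨$⟩ʳ i)) ≡ countF p
countF-permute p π = trans (countF-std (λ i → p (π ⟨$⟩ʳ i)))
  (sym (trans (countF-std p) (StdSumℕ.sum-permute (λ i → if p i then 1 else 0) π)))

countF-not : ∀ {n} (p : Fin n → Bool) → countF (λ i → not (p i)) ℕ.+ countF p ≡ n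
countF-not {zero}  p = refl
countF-not {suc n} p with p zero
... | true  = trans (ℕ.+-suc _ _) (cong suc (countF-not (p ∘ suc)))
... | false = cong suc (countF-not (p ∘ suc))

countF-mono : ∀ {n} (p q : Fin n → Bool) → (∀ i → p i ≡ true → q i ≡ true) → countF p ℕ.≤ countF q
countF-mono {zero}  p q h = z≤n
countF-mono {suc n} p q h with p zero in ep | q zero in eq
... | true  | true  = s≤s (countF-mono (p ∘ suc) (q ∘ suc) (h ∘ suc))
... | true  | false = ⊥-elim (true≢false (h zero ep) eq)
... | false | true  = ℕ.m≤n⇒m≤1+n (countF-mono (p ∘ suc) (q ∘ suc) (h ∘ suc))
... | false | false = countF-mono (p ∘ suc) (q ∘ suc) (h ∘ suc)

countF-strict : ∀ {n} (p q : Fin n → Bool) → (∀ i → p i ≡ true → q i ≡ true) →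
  ∀ j → p j ≡ false → q j ≡ true → countF p ℕ.< countF q
countF-strict {suc n} p q h zero ep eq rewrite ep | eq = s≤s (countF-mono (p ∘ suc) (q ∘ suc) (h ∘ suc))
countF-strict {suc n} p q h (suc j) ep eq with p zero in ep₀ | q zero in eq₀
... | true  | true  = s≤s (countF-strict (p ∘ suc) (q ∘ suc) (h ∘ suc) j ep eq)
... | true  | false = ⊥-elim (true≢false (h zero ep₀) eq₀)
... | false | true  = ℕ.m≤n⇒m≤1+n (countF-strict (p ∘ suc) (q ∘ suc) (h ∘ suc) j ep eq)
... | false | false = countF-strict (p ∘ suc) (q ∘ suc) (h ∘ suc) j ep eq

<ᵇ-true : ∀ {a b} → a ℕ.< b → (a ℕ.<ᵇ b) ≡ true
<ᵇ-true = T⇒true ∘ ℕ.<⇒<ᵇ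

<ᵇ-false : ∀ {a b} → ¬ a ℕ.< b → (a ℕ.<ᵇ b) ≡ false
<ᵇ-false {a} {b} h with a ℕ.<ᵇ b in eq
... | true  = ⊥-elim (h (ℕ.<ᵇ⇒< a b (true⇒T eq)))
... | false = refl

-- The involution exchanges the elements below their image with those above it. For the reversal of
-- darts, this counts the edges.
countF-half : ∀ {n} (π : Permutation′ n) → (∀ i → π ⟨$⟩ʳ (π ⟨$⟩ʳ i) ≡ i) → (∀ i → π ⟨$⟩ʳ i ≢ i) →
  countF (λ i → toℕ i ℕ.<ᵇ toℕ (π ⟨$⟩ʳ i)) ℕ.+ countF (λ i → toℕ i ℕ.<ᵇ toℕ (π ⟨$⟩ʳ i)) ≡ n
countF-half π invol free = trans (cong (ℕ._+ countF p) (trans (sym (countF-permute p π)) (countF-cong flip))) (countF-not p)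
  where
  p = λ i → toℕ i ℕ.<ᵇ toℕ (π ⟨$⟩ʳ i)
  flip : ∀ i → p (π ⟨$⟩ʳ i) ≡ not (p i)
  flip i rewrite invol i with ℕ.<-cmp (toℕ i) (toℕ (π ⟨$⟩ʳ i))
  ... | tri< a _ c = trans (<ᵇ-false c) (sym (cong not (<ᵇ-true a)))
  ... | tri≈ _ b _ = ⊥-elim (free i (sym (Fin.toℕ-injective b)))
  ... | tri> a _ c = trans (<ᵇ-true c) (sym (cong not (<ᵇ-false a)))

cons-if : ∀ {A : Set} (b : Bool) → (b ≡ true → A) → List A → List A
cons-if true  x xs = x refl ∷ xs
cons-if false x xs = xs

-- Entries may depend on the proof of `p i`, since a root dart is available only at a root.
collect : ∀ {n} {A : Set} (p : Fin n → Bool) → (∀ i → p i ≡ true → A) → List A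
collect {zero}  p f = []
collect {suc n} p f = cons-if (p zero) (f zero) (collect (p ∘ suc) (λ i → f (suc i)))

length-collect : ∀ {n} {A : Set} (p : Fin n → Bool) (f : ∀ i → p i ≡ true → A) → length (collect p f) ≡ countF p
length-collect {zero}  p f = refl
length-collect {suc n} p f with p zero | f zero
... | true  | _ = cong suc (length-collect (p ∘ suc) (λ i → f (suc i)))
... | false | _ = length-collect (p ∘ suc) (λ i → f (suc i))

All-cons-if : ∀ {A : Set} {P : A → Set} b (x : b ≡ true → A) xs →
  All P (cons-if b x xs) → (∀ e → P (x e)) × All P xs
All-cons-if true  x xs (px ∷ pxs) = (λ { refl → px }) , pxs
All-cons-if false x xs pxs        = (λ ()) , pxs

All-collect : ∀ {n} {A : Set} {P : A → Set} (p : Fin n → Bool) (f : ∀ i → p i ≡ true → A) →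
  All P (collect p f) → ∀ i pi → P (f i pi)
All-collect {suc n} p f h zero    = proj₁ (All-cons-if (p zero) (f zero) _ h)
All-collect {suc n} p f h (suc i) =
  All-collect (p ∘ suc) (λ i → f (suc i)) (proj₂ (All-cons-if (p zero) (f zero) _ h)) i

module _ {A : Set} (f : A → A) where

  iter-+ : ∀ j k x → iter f (j ℕ.+ k) x ≡ iter f j (iter f k x)
  iter-+ zero    k x = refl
  iter-+ (suc j) k x = cong f (iter-+ j k x)

  iter-suc : ∀ k x → iter f k (f x) ≡ iter f (suc k) x
  iter-suc zero    x = refl
  iter-suc (suc k) x = cong f (iter-suc k x)

  iter-invariant : ∀ {B : Set} (g : A → B) → (∀ x → g (f x) ≡ g x) → ∀ k x → g (iter f k x) ≡ g x
  iter-invariant g h zero    x = refl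
  iter-invariant g h (suc k) x = trans (h _) (iter-invariant g h k x)

  iter-period : ∀ p x → iter f p x ≡ x → ∀ k → iter f (k ℕ.* p) x ≡ x
  iter-period p x h zero    = refl
  iter-period p x h (suc k) = trans (iter-+ p (k ℕ.* p) x) (trans (cong (iter f p) (iter-period p x h k)) h)

module Orbit {m : ℕ} (f : Fin m → Fin m) (f-injective : ∀ {x y} → f x ≡ f y → x ≡ y) where

  iter-injective : ∀ k {x y} → iter f k x ≡ iter f k y → x ≡ y
  iter-injective zero    e = e
  iter-injective (suc k) e = iter-injective k (f-injective e)

  -- Two of the first `m + 1` iterates coincide by the pigeonhole principle, and injectivity cancels
  -- the smaller exponent.
  period : ∀ x → ∃ λ p → (suc p ℕ.≤ m) × iter f (suc p) x ≡ x
  period x with Fin.pigeonhole (ℕ.n<1+n m) (λ k → iter f (toℕ k) x)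
  ... | i , j , i<j , e with ℕ.m≤n⇒∃[o]m+o≡n i<j
  ... | o , 1+i+o≡j = o , ℕ.≤-trans (ℕ.m≤n+m (suc o) (toℕ i)) (subst (ℕ._≤ m) (sym i+1+o≡j) (ℕ.≤-pred (Fin.toℕ<n j))) , sym (iter-injective (toℕ i) (trans e (trans (cong (λ k → iter f k x) (sym i+1+o≡j)) (iter-+ f (toℕ i) (suc o) x))))
    where
    i+1+o≡j : toℕ i ℕ.+ suc o ≡ toℕ j
    i+1+o≡j = trans (ℕ.+-suc (toℕ i) o) 1+i+o≡j

  -- Reduce `k` modulo a period, which is at most `m`. Hence testing `m` iterates, as `orbitCount`
  -- does, tests the whole orbit.
  iter-bounded : ∀ k x → ∃ λ (j : Fin m) → iter f (toℕ j) x ≡ iter f k x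
  iter-bounded k x with period x
  ... | p , p<m , e = fromℕ< r<m , trans (cong (λ j → iter f j x) (Fin.toℕ-fromℕ< r<m)) (sym (begin
      iter f k x                                   ≡⟨ cong (λ j → iter f j x) (ℕ.m≡m%n+[m/n]*n k (suc p)) ⟩
      iter f (r ℕ.+ (k ℕ./ suc p) ℕ.* suc p) x      ≡⟨ iter-+ f r _ x ⟩
      iter f r (iter f ((k ℕ./ suc p) ℕ.* suc p) x) ≡⟨ cong (iter f r) (iter-period f (suc p) x e (k ℕ./ suc p)) ⟩
      iter f r x ∎))
    where
    open ≡-Reasoning
    r = k ℕ.% suc p
    r<m : r ℕ.< m
    r<m = ℕ.<-≤-trans (ℕ.m%n<n k (suc p)) p<m

  _∼_ : Fin m → Fin m → Set
  x ∼ y = ∃ λ k → iter f k x ≡ y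

  ∼-trans : ∀ {x y z} → x ∼ y → y ∼ z → x ∼ z
  ∼-trans {x} (j , refl) (k , refl) = k ℕ.+ j , iter-+ f k j x

  f-∼ : ∀ x → f x ∼ x
  f-∼ x = let p , _ , e = period x in p , trans (iter-suc f p x) e

  ∼-sym : ∀ {x y} → x ∼ y → y ∼ x
  ∼-sym (zero , refl) = zero , refl
  ∼-sym {x} (suc k , refl) = ∼-trans (f-∼ _) (∼-sym (k , refl))

  isLeader : Fin m → Bool
  isLeader x = allF {m} (λ k → toℕ x ℕ.≤ᵇ toℕ (iter f (toℕ k) x))

  isLeader-min : ∀ {x y} → isLeader x ≡ true → x ∼ y → toℕ x ℕ.≤ toℕ y
  isLeader-min {x} lx (k , refl) with iter-bounded k x
  ... | j , e = subst (λ z → toℕ x ℕ.≤ toℕ z) e (ℕ.≤ᵇ⇒≤ _ _ (true⇒T (allF-true {m} (λ k → toℕ x ℕ.≤ᵇ toℕ (iter f (toℕ k) x)) lx j)))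

  isLeader-unique : ∀ {x y} → isLeader x ≡ true → isLeader y ≡ true → x ∼ y → x ≡ y
  isLeader-unique lx ly x∼y = Fin.toℕ-injective (ℕ.≤-antisym (isLeader-min lx x∼y) (isLeader-min ly (∼-sym x∼y)))

  abstract
    -- An element that fails the test has a smaller iterate; the descent ends at the least element
    -- of the orbit.
    leader-exists : ∀ x → Acc ℕ._<_ (toℕ x) → ∃ λ y → isLeader y ≡ true × x ∼ y
    leader-exists x (acc rs) with isLeader x in eq
    ... | true  = x , eq , zero , refl
    ... | false =
      let k , e = allF-false {m} (λ k → toℕ x ℕ.≤ᵇ toℕ (iter f (toℕ k) x)) eq
          y , ly , x∼y = leader-exists (iter f (toℕ k) x) (rs (ℕ.≰⇒> (λ le → true≢false (T⇒true (ℕ.≤⇒≤ᵇ le)) e)))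
      in y , ly , ∼-trans (toℕ k , refl) x∼y

  leader : Fin m → Fin m
  leader x = proj₁ (leader-exists x (<-wellFounded _))

  leader-isLeader : ∀ x → isLeader (leader x) ≡ true
  leader-isLeader x = proj₁ (proj₂ (leader-exists x (<-wellFounded _)))

  leader-∼ : ∀ x → x ∼ leader x
  leader-∼ x = proj₂ (proj₂ (leader-exists x (<-wellFounded _)))

  leader-cong : ∀ {x y} → x ∼ y → leader x ≡ leader y
  leader-cong {x} {y} x∼y = isLeader-unique (leader-isLeader x) (leader-isLeader y)
    (∼-trans (∼-sym (leader-∼ x)) (∼-trans x∼y (leader-∼ y)))

  leader-step : ∀ x → leader (f x) ≡ leader x
  leader-step x = sym (leader-cong (1 , refl))

  leader-fix : ∀ {x} → isLeader x ≡ true → leader x ≡ x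
  leader-fix {x} lx = sym (isLeader-unique lx (leader-isLeader x) (leader-∼ x))

-- Darts of a planar embedding

-- Here `p = m - F` and `q = m - V` count the darts that lead no face and no vertex, `c` the roots,
-- used twice, and `h = m / 2` the edges. Euler's formula turns the sum into `2 m`; the equation is
-- doubled to avoid the half.
equation-count : ∀ m V F c p q h → p ℕ.+ F ≡ m → q ℕ.+ V ≡ m → h ℕ.+ h ≡ m →
  2 ℕ.* (V ℕ.+ F) ≡ m ℕ.+ 4 ℕ.* c → p ℕ.+ (q ℕ.+ (c ℕ.+ (c ℕ.+ h))) ≡ m ℕ.+ m
equation-count m V F c p q h eF eV eh euler = half _ _ (ℕ.+-cancelʳ-≡ (m ℕ.+ 4 ℕ.* c) _ _ (begin
  (S ℕ.+ S) ℕ.+ (m ℕ.+ 4 ℕ.* c)        ≡⟨ cong ((S ℕ.+ S) ℕ.+_) (sym euler) ⟩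
  (S ℕ.+ S) ℕ.+ 2 ℕ.* (V ℕ.+ F)        ≡⟨ regroup p q c h V F ⟩
  2 ℕ.* (p ℕ.+ F) ℕ.+ 2 ℕ.* (q ℕ.+ V) ℕ.+ ((h ℕ.+ h) ℕ.+ 4 ℕ.* c)
    ≡⟨ cong₂ ℕ._+_ (cong₂ (λ x y → 2 ℕ.* x ℕ.+ 2 ℕ.* y) eF eV) (cong (ℕ._+ 4 ℕ.* c) eh) ⟩
  2 ℕ.* m ℕ.+ 2 ℕ.* m ℕ.+ (m ℕ.+ 4 ℕ.* c) ≡⟨ cong (ℕ._+ (m ℕ.+ 4 ℕ.* c)) (double m) ⟩
  (m ℕ.+ m) ℕ.+ (m ℕ.+ m) ℕ.+ (m ℕ.+ 4 ℕ.* c) ∎))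
  where
  open ≡-Reasoning
  S = p ℕ.+ (q ℕ.+ (c ℕ.+ (c ℕ.+ h)))
  regroup : ∀ p q c h V F → ((p ℕ.+ (q ℕ.+ (c ℕ.+ (c ℕ.+ h)))) ℕ.+ (p ℕ.+ (q ℕ.+ (c ℕ.+ (c ℕ.+ h))))) ℕ.+ 2 ℕ.* (V ℕ.+ F)
    ≡ 2 ℕ.* (p ℕ.+ F) ℕ.+ 2 ℕ.* (q ℕ.+ V) ℕ.+ ((h ℕ.+ h) ℕ.+ 4 ℕ.* c)
  regroup = solveℕ
  double : ∀ m → 2 ℕ.* m ℕ.+ 2 ℕ.* m ≡ (m ℕ.+ m) ℕ.+ (m ℕ.+ m)
  double = solveℕ
  half : ∀ a b → a ℕ.+ a ≡ b ℕ.+ b → a ≡ b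
  half a b e = ℕ.*-cancelˡ-≡ a b 2 (trans (two a) (trans e (sym (two b))))
    where
    two : ∀ a → 2 ℕ.* a ≡ a ℕ.+ a
    two = solveℕ

-- The linear system for a potential

module _ {m n : ℕ} (xLeader yLeader below : Fin m → Bool) (isRoot : Fin n → Bool)
  (lx ly rev : Fin m → Fin m) (root : ∀ u → isRoot u ≡ true → Fin m) (t : Fin m → ℚ) where

  -- Unknowns are indexed by all darts, and equations kill those at darts leading no orbit; face
  -- functions are `x ∘ lx` and vertex functions `y ∘ ly`. Thus there are `2 m + 1` unknowns
  -- whatever the orbits are.
  record PotentialSolution : Set where
    field
      x y     : Fin m → ℚ
      scale   : ℚ
      nonzero : ¬ ((∀ d → x d ≡ 0ℚ) × (∀ d → y d ≡ 0ℚ) × scale ≡ 0ℚ)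
      x-other : ∀ d → xLeader d ≡ false → x d ≡ 0ℚ
      y-other : ∀ d → yLeader d ≡ false → y d ≡ 0ℚ
      x-root  : ∀ u r → x (lx (root u r)) ≡ 0ℚ
      y-root  : ∀ u r → y (ly (root u r)) ≡ 0ℚ
      x-edge  : ∀ d → below d ≡ true →
                (x (lx d) - x (lx (rev d))) - (y (ly d) - y (ly (rev d))) - t d * scale ≡ 0ℚ

module PotentialSystem {m n : ℕ} (xLeader yLeader below : Fin m → Bool) (isRoot : Fin n → Bool)
  (lx ly rev : Fin m → Fin m) (root : ∀ u → isRoot u ≡ true → Fin m) (t : Fin m → ℚ)
  (count : countF (not ∘ xLeader) ℕ.+ (countF (not ∘ yLeader) ℕ.+ (countF isRoot ℕ.+ (countF isRoot ℕ.+ countF below))) ≡ m ℕ.+ m)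
  where

  N : ℕ
  N = m ℕ.+ (m ℕ.+ 1)

  ix iy : Fin m → Fin N
  ix d = d Fin.↑ˡ (m ℕ.+ 1)
  iy d = m Fin.↑ʳ (d Fin.↑ˡ 1)

  is : Fin N
  is = m Fin.↑ʳ (m Fin.↑ʳ zero)

  fₑ gₑ : Fin m → Linear N
  fₑ d = var (ix (lx d))
  gₑ d = var (iy (ly d))

  edgeₑ : Fin m → Linear N
  edgeₑ d = (fₑ d ⊖ fₑ (rev d)) ⊖ (gₑ d ⊖ gₑ (rev d)) ⊖ t d ⊛ var is

  E₁ E₂ E₃ E₄ E₅ equations : List (Linear N)
  E₁ = collect (not ∘ xLeader) (λ d _ → var (ix d))
  E₂ = collect (not ∘ yLeader) (λ d _ → var (iy d))
  E₃ = collect isRoot (λ u r → fₑ (root u r))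
  E₄ = collect isRoot (λ u r → gₑ (root u r))
  E₅ = collect below (λ d _ → edgeₑ d)
  equations = E₁ ++ (E₂ ++ (E₃ ++ (E₄ ++ E₅)))

  length-equations : length equations ≡ m ℕ.+ m
  length-equations =
    trans (append E₁ _ (length-collect (not ∘ xLeader) _)
      (append E₂ _ (length-collect (not ∘ yLeader) _)
        (append E₃ _ (length-collect isRoot _)
          (append E₄ E₅ (length-collect isRoot _) (length-collect below _))))) count
    where
    append : ∀ (xs ys : List (Linear N)) {a b} → length xs ≡ a → length ys ≡ b → length (xs ++ ys) ≡ a ℕ.+ b
    append xs ys e e′ = trans (List.length-++ xs) (cong₂ ℕ._+_ e e′)

  enough : length equations ℕ.< N
  enough = subst₂ ℕ._<_ (sym length-equations)
    (trans (sym (ℕ.+-comm (m ℕ.+ m) 1)) (ℕ.+-assoc m m 1)) (ℕ.n<1+n (m ℕ.+ m))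

  abstract
    solution : PotentialSolution xLeader yLeader below isRoot lx ly rev root t
    solution with nontrivial-solution equations enough
    ... | v , (i , vi≢0) , all₁ = record
      { x = v ∘ ix ; y = v ∘ iy ; scale = v is
      ; nonzero = λ { (x0 , y0 , s0) → vi≢0 (v-zero x0 y0 s0 i) }
      ; x-other = λ d e → All-collect {P = P} (not ∘ xLeader) (λ d _ → var (ix d)) (All.++⁻ˡ E₁ all₁) d (cong not e)
      ; y-other = λ d e → All-collect {P = P} (not ∘ yLeader) (λ d _ → var (iy d)) (All.++⁻ˡ E₂ all₂) d (cong not e)
      ; x-root = All-collect {P = P} isRoot (λ u r → fₑ (root u r)) (All.++⁻ˡ E₃ all₃)
      ; y-root = All-collect {P = P} isRoot (λ u r → gₑ (root u r)) (All.++⁻ˡ E₄ all₄)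
      ; x-edge = All-collect {P = P} below (λ d _ → edgeₑ d) (All.++⁻ʳ E₄ all₄)
      }
      where
      P : Linear N → Set
      P e = ⟦ e ⟧ v ≡ 0ℚ
      all₂ : All P (E₂ ++ (E₃ ++ (E₄ ++ E₅)))
      all₂ = All.++⁻ʳ {P = P} E₁ all₁
      all₃ : All P (E₃ ++ (E₄ ++ E₅))
      all₃ = All.++⁻ʳ {P = P} E₂ all₂
      all₄ : All P (E₄ ++ E₅)
      all₄ = All.++⁻ʳ {P = P} E₃ all₃
      v-zero : (∀ d → v (ix d) ≡ 0ℚ) → (∀ d → v (iy d) ≡ 0ℚ) → v is ≡ 0ℚ → ∀ i → v i ≡ 0ℚ
      v-zero x0 y0 s0 i with Fin.splitAt m i in eq
      ... | inj₁ d = subst (λ i → v i ≡ 0ℚ) (Fin.splitAt⁻¹-↑ˡ eq) (x0 d)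
      ... | inj₂ j with Fin.splitAt m j in eq′
      ... | inj₁ d = subst (λ i → v i ≡ 0ℚ) (trans (cong (m Fin.↑ʳ_) (Fin.splitAt⁻¹-↑ˡ eq′)) (Fin.splitAt⁻¹-↑ʳ eq)) (y0 d)
      ... | inj₂ zero = subst (λ i → v i ≡ 0ℚ) (trans (cong (m Fin.↑ʳ_) (Fin.splitAt⁻¹-↑ʳ eq′)) (Fin.splitAt⁻¹-↑ʳ eq)) s0

-- Faces, vertices and components of the embedding

∧-true : ∀ {a b} → a ∧ b ≡ true → a ≡ true × b ≡ true
∧-true {true} {true} _ = refl , refl

∧-false : ∀ {a b} → a ∧ b ≡ false → a ≡ true → b ≡ false
∧-false e refl = e

∨-true : ∀ {a b} → a ∨ b ≡ true → a ≡ true ⊎ b ≡ true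
∨-true {true}  _ = inj₁ refl
∨-true {false} e = inj₂ e

eqF⇒≡ : ∀ {n} {i j : Fin n} → eqF i j ≡ true → i ≡ j
eqF⇒≡ {i = i} {j} e = Fin.toℕ-injective (ℕ.≡ᵇ⇒≡ (toℕ i) (toℕ j) (true⇒T e))

module Embedding {n : ℕ} {G : SimpleGraph n} (R : RotationSystem G)
  (euler : 2 ℕ.* (vertexCount R ℕ.+ faceCount R) ≡ m R ℕ.+ 4 ℕ.* nontrivialComponents G) where

  Dart : Set
  Dart = Fin (m R)

  org : Dart → Fin n
  org = tail R

  rev rot next : Dart → Dart
  rev d = α R ⟨$⟩ʳ d
  rot d = σ R ⟨$⟩ʳ d
  next d = rot (rev d)

  rev-rev : ∀ d → rev (rev d) ≡ d
  rev-rev = α-invol R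

  rev-injective : ∀ {x y} → rev x ≡ rev y → x ≡ y
  rev-injective {x} {y} e = trans (sym (rev-rev x)) (trans (cong rev e) (rev-rev y))

  rot-injective : ∀ {x y} → rot x ≡ rot y → x ≡ y
  rot-injective {x} {y} e = trans (sym (inverseˡ (σ R))) (trans (cong (σ R ⟨$⟩ˡ_) e) (inverseˡ (σ R)))

  adj-distinct : ∀ {u v} → adj G u v ≡ true → u ≢ v
  adj-distinct {u} e refl = true≢false e (irrefl G u)

  rev-free : ∀ d → rev d ≢ d
  rev-free d e = adj-distinct (dart-edge R d) (cong org (sym e))

  rev-swap : ∀ {d e} → rev d ≡ e → rev e ≡ d
  rev-swap refl = rev-rev _

  dart-≡ : ∀ {d e} → org d ≡ org e → org (rev d) ≡ org (rev e) → d ≡ e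
  dart-≡ = dart-inj R _ _

  module Face = Orbit next (rev-injective ∘ rot-injective)
  module Vertex = Orbit rot rot-injective

  -- The predicate counted by `nontrivialComponents`.
  isRoot : Fin n → Bool
  isRoot u = anyF (adj G u) ∧ not (anyF (λ v → (toℕ v ℕ.<ᵇ toℕ u) ∧ reach G n v u))

  -- Chooses the outer face of the component, namely the face of this dart; potentials and insides
  -- vanish there.
  rootDart : ∀ u → isRoot u ≡ true → Dart
  rootDart u r = let v , uv = anyF-true (adj G u) (proj₁ (∧-true r)) in proj₁ (dart-surj R u v uv)

  rootDart-org : ∀ u r → org (rootDart u r) ≡ u
  rootDart-org u r = let v , uv = anyF-true (adj G u) (proj₁ (∧-true r)) in proj₁ (proj₂ (dart-surj R u v uv))

  module _ {B : Set} (J : Dart → B) where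

    FaceConstant : Set
    FaceConstant = ∀ d → J (next d) ≡ J d

    VertexConstant : Set
    VertexConstant = ∀ d → J (rot d) ≡ J d

    AtRoots : B → Set
    AtRoots b = ∀ u r → J (rootDart u r) ≡ b

    vertex-constant : VertexConstant → ∀ {d e} → org d ≡ org e → J d ≡ J e
    vertex-constant h {d} {e} oe = let k , ke = σ-cyclic R d e oe in
      trans (sym (iter-invariant rot J h k d)) (cong J ke)

    module _ (hv : VertexConstant) (hr : ∀ d → J (rev d) ≡ J d) where

      -- Follow the walk backwards from `u`: `J` survives the reversal of a dart and the change of
      -- dart at a vertex.
      reach-constant : ∀ t v u → reach G t v u ≡ true → ∀ d → org d ≡ u → ∃ λ e → org e ≡ v × J e ≡ J d
      reach-constant zero v u h d od = d , trans od (sym (eqF⇒≡ h)) , refl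
      reach-constant (suc t) v u h d od with ∨-true h
      ... | inj₁ h′ = reach-constant t v u h′ d od
      ... | inj₂ h′ with anyF-true (λ w → reach G t v w ∧ adj G w u) h′
      ... | w , h″ with ∧-true h″
      ... | vw , wu with dart-surj R w u wu
      ... | e , oe , he with reach-constant t v w vw e oe
      ... | e′ , oe′ , Je′ = e′ , oe′ , trans Je′ (trans (sym (hr e)) (vertex-constant hv (trans he (sym od))))

      -- A vertex that is no root is reached from a smaller one, where `J` takes the same value; the
      -- descent ends at a root.
      root-constant : ∀ {b} → AtRoots b → ∀ u → Acc ℕ._<_ (toℕ u) → ∀ d → org d ≡ u → J d ≡ b
      root-constant hb u (acc rs) d od with anyF (λ v → (toℕ v ℕ.<ᵇ toℕ u) ∧ reach G n v u) in eq
      ... | false = trans (vertex-constant hv (trans od (sym (rootDart-org u r)))) (hb u r)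
        where
        r : isRoot u ≡ true
        r = cong₂ (λ x y → x ∧ not y) (anyF-intro (adj G u) (org (rev d)) (subst (λ u → adj G u (org (rev d)) ≡ true) od (dart-edge R d))) eq
      ... | true with anyF-true (λ v → (toℕ v ℕ.<ᵇ toℕ u) ∧ reach G n v u) eq
      ... | v , h with ∧-true h
      ... | v<u , vu with reach-constant n v u vu d od
      ... | e , oe , Je = trans (sym Je) (root-constant hb v (rs (ℕ.<ᵇ⇒< _ _ (true⇒T v<u))) e oe)

      all-constant : ∀ {b} → AtRoots b → ∀ d → J d ≡ b
      all-constant hb d = root-constant hb (org d) (<-wellFounded _) d refl

    -- As `next` is `rot` after `rev`, invariance under `next` and `rev` gives invariance under
    -- `rot`.
    all-constant′ : FaceConstant → (∀ d → J (rev d) ≡ J d) → ∀ {b} → AtRoots b → ∀ d → J d ≡ b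
    all-constant′ hf hr = all-constant
      (λ d → trans (cong (J ∘ rot) (sym (rev-rev d))) (trans (hf (rev d)) (hr d))) hr

  sum-rev : ∀ (f : Dart → ℚ) → sum (f ∘ rev) ≡ sum f
  sum-rev f = sum-permute f (α R)

  sum-rot : ∀ (f : Dart → ℚ) → sum (f ∘ rot) ≡ sum f
  sum-rot f = sum-permute f (σ R)

  sum-next : ∀ (f : Dart → ℚ) → sum (f ∘ next) ≡ sum f
  sum-next f = trans (sum-rev (f ∘ rot)) (sum-rot f)

  -- A closed flow t is the difference across edges of a face potential f.  The unknowns of the
  -- linear system are a face function f, a vertex function g and a scale λ, subject to
  -- f d - f (rev d) - (g d - g (rev d)) = λ t d, with f and g vanishing at the roots.
  -- By Euler's formula there is one equation less than there are unknowns.  In a solution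
  -- Σ (g (rev d) - g d)² = 0, because gradients of vertex functions are orthogonal to the
  -- flows around faces and to t; so g = 0, and λ = 0 would force f = 0.
  module Potential (t : Dart → ℚ) (t-rev : ∀ d → t (rev d) ≡ - t d)
    (t-closed : ∀ g → VertexConstant g → sum (λ d → t d * (g (rev d) - g d)) ≡ 0ℚ) where

    below : Dart → Bool
    below d = toℕ d ℕ.<ᵇ toℕ (rev d)

    abstract
      solution : PotentialSolution Face.isLeader Vertex.isLeader below isRoot Face.leader Vertex.leader rev rootDart t
      solution = PotentialSystem.solution Face.isLeader Vertex.isLeader below isRoot Face.leader Vertex.leader rev rootDart t
        (equation-count (m R) (vertexCount R) (faceCount R) (nontrivialComponents G)
          (countF (not ∘ Face.isLeader)) (countF (not ∘ Vertex.isLeader)) (countF below)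
          (countF-not Face.isLeader) (countF-not Vertex.isLeader) (countF-half (α R) rev-rev rev-free) euler)

    open PotentialSolution solution

    f g : Dart → ℚ
    f d = x (Face.leader d)
    g d = y (Vertex.leader d)

    f-face : FaceConstant f
    f-face d = cong x (Face.leader-step d)

    g-vertex : VertexConstant g
    g-vertex d = cong y (Vertex.leader-step d)

    x-zero : (∀ d → f d ≡ 0ℚ) → ∀ d → x d ≡ 0ℚ
    x-zero f0 d = by-cases (Face.isLeader d)
      (λ e → trans (cong x (sym (Face.leader-fix e))) (f0 d)) (x-other d)

    y-zero : (∀ d → g d ≡ 0ℚ) → ∀ d → y d ≡ 0ℚ
    y-zero g0 d = by-cases (Vertex.isLeader d)
      (λ e → trans (cong y (sym (Vertex.leader-fix e))) (g0 d)) (y-other d)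

    -- The system has one equation per edge, at the smaller dart; both sides change sign under
    -- reversal.
    edge : ∀ d → (f d - f (rev d)) - (g d - g (rev d)) - t d * scale ≡ 0ℚ
    edge d with ℕ.<-cmp (toℕ d) (toℕ (rev d))
    ... | tri< a _ _ = x-edge d (<ᵇ-true a)
    ... | tri≈ _ b _ = ⊥-elim (rev-free d (Fin.toℕ-injective (sym b)))
    ... | tri> _ _ c = trans (flip (f d) (f (rev d)) (g d) (g (rev d)) (t d) scale)
        (cong -_ (subst₂ (λ x y → (f (rev d) - f x) - (g (rev d) - g x) - y * scale ≡ 0ℚ) (rev-rev d) (t-rev d)
          (x-edge (rev d) (<ᵇ-true (subst (λ x → toℕ (rev d) ℕ.< toℕ x) (sym (rev-rev d)) c)))))
      where
      flip : ∀ a b c e t s → (a - b) - (c - e) - t * s ≡ - ((b - a) - (e - c) - - t * s)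
      flip = solve-∀ ringℚ

    h : Dart → ℚ
    h d = g (rev d) - g d

    h-rev : ∀ d → h (rev d) ≡ - h d
    h-rev d = trans (cong (λ x → g x - g (rev d)) (rev-rev d)) (l (g d) (g (rev d)))
      where
      l : ∀ a b → a - b ≡ - (b - a)
      l = solve-∀ ringℚ

    -- Summation by parts: `g (rev d) = g (next d)` and `f d = f (next d)`, so the two halves of the
    -- sum differ only by reindexing along `next`.
    sum-hf : sum (λ d → h d * f d) ≡ 0ℚ
    sum-hf = begin
      sum (λ d → h d * f d)                              ≡⟨ sum-cong (λ d → l (g (rev d)) (g d) (f d)) ⟩
      sum (λ d → g (rev d) * f d - g d * f d)            ≡⟨ sum-- (λ d → g (rev d) * f d) (λ d → g d * f d) ⟩
      sum (λ d → g (rev d) * f d) - sum (λ d → g d * f d)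
        ≡⟨ cong (λ x → x - sum (λ d → g d * f d)) (sum-cong (λ d → cong₂ _*_ (sym (g-vertex (rev d))) (sym (f-face d)))) ⟩
      sum (λ d → g (next d) * f (next d)) - sum (λ d → g d * f d)
        ≡⟨ cong (λ x → x - sum (λ d → g d * f d)) (sum-next (λ d → g d * f d)) ⟩
      sum (λ d → g d * f d) - sum (λ d → g d * f d)      ≡⟨ ℚ.+-inverseʳ (sum (λ d → g d * f d)) ⟩
      0ℚ ∎
      where
      open ≡-Reasoning
      l : ∀ a b c → (a - b) * c ≡ a * c - b * c
      l = solve-∀ ringℚ

    sum-hf-rev : sum (λ d → h d * f (rev d)) ≡ 0ℚ
    sum-hf-rev = begin
      sum (λ d → h d * f (rev d))                 ≡⟨ sum-cong (λ d → trans (l (h d) (f (rev d))) (cong (λ x → - 1ℚ * (x * f (rev d))) (sym (h-rev d)))) ⟩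
      sum (λ d → - 1ℚ * (h (rev d) * f (rev d)))  ≡⟨ sym (*-distribˡ-sum (- 1ℚ) (λ d → h (rev d) * f (rev d))) ⟩
      - 1ℚ * sum (λ d → h (rev d) * f (rev d))    ≡⟨ cong (- 1ℚ *_) (trans (sum-rev (λ d → h d * f d)) sum-hf) ⟩
      0ℚ ∎
      where
      open ≡-Reasoning
      l : ∀ a b → a * b ≡ - 1ℚ * ((- a) * b)
      l = solve-∀ ringℚ

    energy : sum (λ d → h d * h d) ≡ 0ℚ
    energy = begin
      sum (λ d → h d * h d) ≡⟨ sum-cong split ⟩
      sum (λ d → scale * (t d * h d) + (h d * f (rev d) - h d * f d)) ≡⟨ sum-+ (λ d → scale * (t d * h d)) (λ d → h d * f (rev d) - h d * f d) ⟩
      sum (λ d → scale * (t d * h d)) + sum (λ d → h d * f (rev d) - h d * f d)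
        ≡⟨ cong₂ _+_ (trans (sym (*-distribˡ-sum scale (λ d → t d * h d))) (trans (cong (scale *_) (t-closed g g-vertex)) (ℚ.*-zeroʳ scale)))
                     (trans (sum-- (λ d → h d * f (rev d)) (λ d → h d * f d)) (cong₂ _-_ sum-hf-rev sum-hf)) ⟩
      0ℚ ∎
      where
      open ≡-Reasoning
      -- The last summand is `h d` times the left side of the edge equation, hence zero.
      l : ∀ a b c e t s → (e - c) * (e - c) ≡ s * (t * (e - c)) + ((e - c) * b - (e - c) * a) + (e - c) * ((a - b) - (c - e) - t * s)
      l = solve-∀ ringℚ
      split : ∀ d → h d * h d ≡ scale * (t d * h d) + (h d * f (rev d) - h d * f d)
      split d = trans (l (f d) (f (rev d)) (g d) (g (rev d)) (t d) scale)
        (trans (cong (λ x → scale * (t d * h d) + (h d * f (rev d) - h d * f d) + h d * x) (edge d))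
               (trans (cong (λ x → scale * (t d * h d) + (h d * f (rev d) - h d * f d) + x) (ℚ.*-zeroʳ (h d))) (ℚ.+-identityʳ _)))

    g-zero : ∀ d → g d ≡ 0ℚ
    g-zero = all-constant g g-vertex
      (λ d → minus-zero (square-zero (h d) (sum-nonneg-zero (λ d → h d * h d) (λ d → square-nonneg (h d)) energy d))) y-root

    f-edge : ∀ d → f d - f (rev d) ≡ t d * scale
    f-edge d = minus-zero (trans (cong (λ x → x - t d * scale) (trans (l (f d) (f (rev d))) (cong₂ (λ x y → (f d - f (rev d)) - (x - y)) (sym (g-zero d)) (sym (g-zero (rev d)))))) (edge d))
      where
      l : ∀ a b → a - b ≡ (a - b) - (0ℚ - 0ℚ)
      l = solve-∀ ringℚ

    scale≢0 : scale ≢ 0ℚ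
    scale≢0 s≡0 = nonzero (x-zero f-zero , y-zero g-zero , s≡0)
      where
      f-zero : ∀ d → f d ≡ 0ℚ
      f-zero = all-constant′ f f-face (λ d → sym (minus-zero (trans (f-edge d) (trans (cong (t d *_) s≡0) (ℚ.*-zeroʳ (t d)))))) x-root

    instance _ = ℚ.≢-nonZero scale≢0

    potential : Σ (Dart → ℚ) λ f → FaceConstant f × AtRoots f 0ℚ × (∀ d → f d - f (rev d) ≡ t d)
    potential = (λ d → 1/ scale * f d) , (λ d → cong (1/ scale *_) (f-face d)) ,
      (λ u r → trans (cong (1/ scale *_) (x-root u r)) (ℚ.*-zeroʳ (1/ scale))) ,
      λ d → trans (l (1/ scale) (f d) (f (rev d))) (trans (cong (1/ scale *_) (f-edge d)) (trans (l′ (1/ scale) (t d) scale)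
        (trans (cong (t d *_) (ℚ.*-inverseˡ scale)) (ℚ.*-identityʳ (t d)))))
      where
      l : ∀ q a b → q * a - q * b ≡ q * (a - b)
      l = solve-∀ ringℚ
      l′ : ∀ q t s → q * (t * s) ≡ t * (q * s)
      l′ = solve-∀ ringℚ

-- The region enclosed by a triangle

after : Fin 3 → Fin 3
after zero             = suc zero
after (suc zero)       = suc (suc zero)
after (suc (suc zero)) = zero

after-cases : ∀ i j → i ≡ j ⊎ j ≡ after i ⊎ i ≡ after j
after-cases zero             zero             = inj₁ refl
after-cases zero             (suc zero)       = inj₂ (inj₁ refl)
after-cases zero             (suc (suc zero)) = inj₂ (inj₂ refl)
after-cases (suc zero)       zero             = inj₂ (inj₂ refl)
after-cases (suc zero)       (suc zero)       = inj₁ refl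
after-cases (suc zero)       (suc (suc zero)) = inj₂ (inj₁ refl)
after-cases (suc (suc zero)) zero             = inj₂ (inj₁ refl)
after-cases (suc (suc zero)) (suc zero)       = inj₂ (inj₂ refl)
after-cases (suc (suc zero)) (suc (suc zero)) = inj₁ refl

thrice : ∀ i → after (after (after i)) ≡ i
thrice zero             = refl
thrice (suc zero)       = refl
thrice (suc (suc zero)) = refl

after-injective : ∀ {i j} → after i ≡ after j → i ≡ j
after-injective {i} {j} e = trans (sym (thrice i)) (trans (cong (after ∘ after) e) (thrice j))

after-after : ∀ i → i ≢ after (after i)
after-after zero             ()
after-after (suc zero)       ()
after-after (suc (suc zero)) ()

[_] : Bool → ℚ
[ b ] = if b then 1ℚ else 0ℚ

_==_ : ∀ {n} → Fin n → Fin n → Bool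
i == j = does (i Fin.≟ j)

==-true : ∀ {n} {i j : Fin n} → i ≡ j → (i == j) ≡ true
==-true {i = i} {j} = dec-true (i Fin.≟ j)

==-false : ∀ {n} {i j : Fin n} → i ≢ j → (i == j) ≡ false
==-false {i = i} {j} = dec-false (i Fin.≟ j)

1ℚ≢0ℚ : 1ℚ ≢ 0ℚ
1ℚ≢0ℚ ()

module Regions {n : ℕ} {G : SimpleGraph n} (R : RotationSystem G)
  (euler : 2 ℕ.* (vertexCount R ℕ.+ faceCount R) ≡ m R ℕ.+ 4 ℕ.* nontrivialComponents G) where

  open Embedding R euler

  -- A directed closed walk of three darts. Since the graph has no loops, linked darts already have
  -- three distinct corners.
  record Triangle : Set where
    field
      side : Fin 3 → Dart
      link : ∀ i → org (rev (side i)) ≡ org (side (after i))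

    corner : Fin 3 → Fin n
    corner i = org (side i)

    On : Dart → Set
    On d = ∃ λ i → d ≡ side i ⊎ rev d ≡ side i

    on? : ∀ d → Dec (On d)
    on? d = Fin.any? λ i → (d Fin.≟ side i) ⊎-dec (rev d Fin.≟ side i)

    On-rev : ∀ {d} → On d → On (rev d)
    On-rev (i , inj₁ e) = i , inj₂ (trans (rev-rev _) e)
    On-rev (i , inj₂ e) = i , inj₁ e

    On-rev⁻ : ∀ {d} → On (rev d) → On d
    On-rev⁻ {d} o = subst On (rev-rev d) (On-rev o)

    On-corner : ∀ {d} → On d → ∃ λ i → org d ≡ corner i
    On-corner (i , inj₁ e) = i , cong org e
    On-corner (i , inj₂ e) = after i , trans (cong org (sym (rev-swap e))) (link i)

    corner-after : ∀ i → corner i ≢ corner (after i)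
    corner-after i e = adj-distinct (dart-edge R (side i)) (trans e (sym (link i)))

    corner-injective : ∀ {i j} → corner i ≡ corner j → i ≡ j
    corner-injective {i} {j} e with after-cases i j
    ... | inj₁ i≡j = i≡j
    ... | inj₂ (inj₁ refl) = ⊥-elim (corner-after i e)
    ... | inj₂ (inj₂ refl) = ⊥-elim (corner-after j (sym e))

    -- Two distinct corners are consecutive in one of the two directions, and there are no parallel
    -- edges.
    chord-On : ∀ d i j → org d ≡ corner i → org (rev d) ≡ corner j → On d
    chord-On d i j oi oj with after-cases i j
    ... | inj₁ refl = ⊥-elim (adj-distinct (dart-edge R d) (trans oi (sym oj)))
    ... | inj₂ (inj₁ refl) = i , inj₁ (dart-≡ oi (trans oj (sym (link i))))
    ... | inj₂ (inj₂ refl) = j , inj₂ (dart-≡ oj (trans (trans (cong org (rev-rev d)) oi) (sym (link j))))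

    side-injective : ∀ {i j} → side i ≡ side j → i ≡ j
    side-injective e = corner-injective (cong org e)

    -- Comparing origins gives `j = after i`, comparing heads gives `i = after j`; together they
    -- contradict `after-after`.
    side-rev : ∀ i j → rev (side i) ≢ side j
    side-rev i j e = after-after i (trans
      (corner-injective (trans (trans (sym (cong org (rev-rev (side i)))) (cong (org ∘ rev) e)) (link j)))
      (cong after (sym (corner-injective (trans (sym (link i)) (cong org e))))))

  open Triangle

  -- The unit flow along `x`; the sum over the three sides is the flow around the triangle.
  unit : Dart → Dart → ℚ
  unit x d = [ d == x ] - [ rev d == x ]

  unit-rev : ∀ x d → unit x (rev d) ≡ - unit x d
  unit-rev x d = trans (cong (λ y → [ rev d == x ] - [ y == x ]) (rev-rev d)) (l [ rev d == x ] [ d == x ])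
    where
    l : ∀ a b → a - b ≡ - (b - a)
    l = solve-∀ ringℚ

  sum-== : ∀ x (h : Dart → ℚ) → sum (λ d → [ d == x ] * h d) ≡ h x
  sum-== x h = trans (sum-single (λ d → [ d == x ] * h d) x
      (λ d d≢x → trans (cong (λ b → [ b ] * h d) (==-false d≢x)) (ℚ.*-zeroˡ (h d))))
    (trans (cong (λ b → [ b ] * h x) (==-true {i = x} refl)) (ℚ.*-identityˡ (h x)))

  sum-unit : ∀ x (h : Dart → ℚ) → sum (λ d → unit x d * h d) ≡ h x - h (rev x)
  sum-unit x h = begin
    sum (λ d → unit x d * h d)
      ≡⟨ sum-cong (λ d → trans (l [ d == x ] [ rev d == x ] (h d)) (cong (λ e → [ d == x ] * h d - [ rev d == x ] * h e) (sym (rev-rev d)))) ⟩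
    sum (λ d → [ d == x ] * h d - [ rev d == x ] * h (rev (rev d)))
      ≡⟨ sum-- (λ d → [ d == x ] * h d) (λ d → [ rev d == x ] * h (rev (rev d))) ⟩
    sum (λ d → [ d == x ] * h d) - sum (λ d → [ rev d == x ] * h (rev (rev d)))
      ≡⟨ cong₂ _-_ (sum-== x h) (trans (sum-rev (λ d → [ d == x ] * h (rev d))) (sum-== x (h ∘ rev))) ⟩
    h x - h (rev x) ∎
    where
    open ≡-Reasoning
    l : ∀ a b c → (a - b) * c ≡ a * c - b * c
    l = solve-∀ ringℚ

  module Boundary (T : Triangle) where

    x₀ x₁ x₂ : Dart
    x₀ = side T zero
    x₁ = side T (suc zero)
    x₂ = side T (suc (suc zero))

    t : Dart → ℚ
    t d = unit x₀ d + unit x₁ d + unit x₂ d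

    t-rev : ∀ d → t (rev d) ≡ - t d
    t-rev d = trans (cong₂ _+_ (cong₂ _+_ (unit-rev x₀ d) (unit-rev x₁ d)) (unit-rev x₂ d))
                    (l (unit x₀ d) (unit x₁ d) (unit x₂ d))
      where
      l : ∀ a b c → - a + - b + - c ≡ - (a + b + c)
      l = solve-∀ ringℚ

    -- Pairing with a gradient adds up the differences of `g` around the three corners, and these
    -- telescope.
    t-closed : ∀ g → VertexConstant g → sum (λ d → t d * (g (rev d) - g d)) ≡ 0ℚ
    t-closed g gv = begin
      sum (λ d → t d * h d) ≡⟨ sum-cong (λ d → l (unit x₀ d) (unit x₁ d) (unit x₂ d) (h d)) ⟩
      sum (λ d → (u₀ d + u₁ d) + u₂ d) ≡⟨ sum-+ (λ d → u₀ d + u₁ d) u₂ ⟩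
      sum (λ d → u₀ d + u₁ d) + sum u₂ ≡⟨ cong (_+ sum u₂) (sum-+ u₀ u₁) ⟩
      sum u₀ + sum u₁ + sum u₂ ≡⟨ cong₂ _+_ (cong₂ _+_ (sum-unit x₀ h) (sum-unit x₁ h)) (sum-unit x₂ h) ⟩
      (h x₀ - h (rev x₀)) + (h x₁ - h (rev x₁)) + (h x₂ - h (rev x₂)) ≡⟨ cong₂ _+_ (cong₂ _+_ (e zero) (e (suc zero))) (e (suc (suc zero))) ⟩
      (g x₁ - g x₀ - (g x₀ - g x₁)) + (g x₂ - g x₁ - (g x₁ - g x₂)) + (g x₀ - g x₂ - (g x₂ - g x₀)) ≡⟨ l′ (g x₀) (g x₁) (g x₂) ⟩
      0ℚ ∎
      where
      open ≡-Reasoning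
      h u₀ u₁ u₂ : Dart → ℚ
      h d = g (rev d) - g d
      u₀ d = unit x₀ d * h d
      u₁ d = unit x₁ d * h d
      u₂ d = unit x₂ d * h d
      l : ∀ a b c k → (a + b + c) * k ≡ (a * k + b * k) + c * k
      l = solve-∀ ringℚ
      l′ : ∀ a b c → (b - a - (a - b)) + (c - b - (b - c)) + (a - c - (c - a)) ≡ 0ℚ
      l′ = solve-∀ ringℚ
      e : ∀ i → h (side T i) - h (rev (side T i)) ≡ (g (side T (after i)) - g (side T i)) - (g (side T i) - g (side T (after i)))
      e i = cong₂ _-_ (cong (_- g (side T i)) k) (cong₂ _-_ (cong g (rev-rev (side T i))) k)
        where
        k : g (rev (side T i)) ≡ g (side T (after i))
        k = vertex-constant g gv (link T i)

    add : ∀ {a b c a′ b′ c′ s} → a ≡ a′ → b ≡ b′ → c ≡ c′ → a′ + b′ + c′ ≡ s → a + b + c ≡ s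
    add refl refl refl e = e

    unit-other : ∀ {i j} → i ≢ j → unit (side T j) (side T i) ≡ 0ℚ
    unit-other {i} {j} i≢j = cong₂ (λ a b → [ a ] - [ b ]) (==-false (i≢j ∘ side-injective T)) (==-false (side-rev T i j))

    unit-same : ∀ i → unit (side T i) (side T i) ≡ 1ℚ
    unit-same i = cong₂ (λ a b → [ a ] - [ b ]) (==-true {i = side T i} refl) (==-false (side-rev T i i))

    t-side : ∀ i → t (side T i) ≡ 1ℚ
    t-side zero             = add (unit-same zero) (unit-other {zero} {suc zero} λ ()) (unit-other {zero} {suc (suc zero)} λ ()) refl
    t-side (suc zero)       = add (unit-other {suc zero} {zero} λ ()) (unit-same (suc zero)) (unit-other {suc zero} {suc (suc zero)} λ ()) refl
    t-side (suc (suc zero)) = add (unit-other {suc (suc zero)} {zero} λ ()) (unit-other {suc (suc zero)} {suc zero} λ ()) (unit-same (suc (suc zero))) refl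

    t-on : ∀ {d} → On T d → t d ≢ 0ℚ
    t-on (i , inj₁ refl) e = 1ℚ≢0ℚ (trans (sym (t-side i)) e)
    t-on {d} (i , inj₂ e) e′ = 1ℚ≢0ℚ (trans (sym (t-side i)) (trans (cong t (sym e)) (trans (t-rev d) (cong -_ e′))))

    t-off : ∀ {d} → ¬ On T d → t d ≡ 0ℚ
    t-off {d} off = add (z zero) (z (suc zero)) (z (suc (suc zero))) refl
      where
      z : ∀ i → unit (side T i) d ≡ 0ℚ
      z i = cong₂ (λ a b → [ a ] - [ b ]) (==-false λ e → off (i , inj₁ e)) (==-false λ e → off (i , inj₂ e))

    abstract
      potential : Σ (Dart → ℚ) λ f → FaceConstant f × AtRoots f 0ℚ × (∀ d → f d - f (rev d) ≡ t d)
      potential = Potential.potential t t-rev t-closed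

    f : Dart → ℚ
    f = proj₁ potential

    f-face : FaceConstant f
    f-face = proj₁ (proj₂ potential)

    f-root : AtRoots f 0ℚ
    f-root = proj₁ (proj₂ (proj₂ potential))

    f-edge : ∀ d → f d - f (rev d) ≡ t d
    f-edge = proj₂ (proj₂ (proj₂ potential))

    f-off : ∀ {d} → ¬ On T d → f d ≡ f (rev d)
    f-off {d} off = minus-zero (trans (f-edge d) (t-off off))

    -- The flow J d - J (rev d) out of a vertex sums to zero.
    lone-edge : ∀ J → FaceConstant J → ∀ d₀ →
      (∀ d → org d ≡ org d₀ → d ≢ d₀ → J d ≡ J (rev d)) → J d₀ ≡ J (rev d₀)
    lone-edge J Jf d₀ h = minus-zero (trans (sym at) (trans (sym (sum-single F d₀ off)) total))
      where
      K F : Dart → ℚ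
      K d = [ org d == org d₀ ] * J d
      F d = [ org d == org d₀ ] * (J d - J (rev d))
      at : F d₀ ≡ J d₀ - J (rev d₀)
      at = trans (cong (λ b → [ b ] * (J d₀ - J (rev d₀))) (==-true {i = org d₀} refl)) (ℚ.*-identityˡ (J d₀ - J (rev d₀)))
      off : ∀ d → d ≢ d₀ → F d ≡ 0ℚ
      off d d≢d₀ with org d Fin.≟ org d₀
      ... | no _ = ℚ.*-zeroˡ (J d - J (rev d))
      ... | yes e = trans (cong (λ x → 1ℚ * (x - J (rev d))) (h d e d≢d₀)) (l (J (rev d)))
        where
        l : ∀ a → 1ℚ * (a - a) ≡ 0ℚ
        l = solve-∀ ringℚ
      J-rot : ∀ d → J (rev d) ≡ J (rot d)
      J-rot d = trans (sym (Jf (rev d))) (cong (J ∘ rot) (rev-rev d))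
      total : sum F ≡ 0ℚ
      total = begin
        sum F ≡⟨ sum-cong (λ d → trans (l [ org d == org d₀ ] (J d) (J (rev d)))
                   (cong₂ (λ a b → K d - [ a == org d₀ ] * b) (sym (σ-tail R d)) (J-rot d))) ⟩
        sum (λ d → K d - K (rot d)) ≡⟨ sum-- K (K ∘ rot) ⟩
        sum K - sum (K ∘ rot) ≡⟨ cong (λ x → sum K - x) (sum-rot K) ⟩
        sum K - sum K ≡⟨ ℚ.+-inverseʳ (sum K) ⟩
        0ℚ ∎
        where
        open ≡-Reasoning
        l : ∀ a b c → a * (b - c) ≡ a * b - a * c
        l = solve-∀ ringℚ

    -- Subtracting a multiple of f makes the difference vanish on one side of the triangle,
    -- and then on the others, one vertex after the other.
    potential-unique : ∀ J → FaceConstant J → AtRoots J 0ℚ → (∀ d → ¬ On T d → J d ≡ J (rev d)) →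
      ∃ λ k → ∀ d → J d ≡ k * f d
    potential-unique J Jf Jr Joff = k , λ d → minus-zero (all-constant′ K K-face (λ d → sym (K-edge d)) K-root d)
      where
      k : ℚ
      -- The jump of `f` across `x₀` is 1, so subtracting this multiple removes the jump of `J`
      -- there.
      k = J x₀ - J (rev x₀)
      K : Dart → ℚ
      K d = J d - k * f d
      K-face : FaceConstant K
      K-face d = cong₂ (λ a b → a - k * b) (Jf d) (f-face d)
      K-root : AtRoots K 0ℚ
      K-root u r = trans (cong₂ (λ a b → a - k * b) (Jr u r) (f-root u r)) (l k)
        where
        l : ∀ k → 0ℚ - k * 0ℚ ≡ 0ℚ
        l = solve-∀ ringℚ
      K-off : ∀ {d} → ¬ On T d → K d ≡ K (rev d)
      K-off off = cong₂ (λ a b → a - k * b) (Joff _ off) (f-off off)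
      K-rev : ∀ {d} → K d ≡ K (rev d) → K (rev d) ≡ K (rev (rev d))
      K-rev {d} e = trans (sym e) (cong K (sym (rev-rev d)))
      K₀ : K x₀ ≡ K (rev x₀)
      K₀ = minus-zero (trans (l (J x₀) (J (rev x₀)) (f x₀) (f (rev x₀)))
        (trans (cong (λ x → k - k * x) (trans (f-edge x₀) (t-side zero))) (l′ k)))
        where
        l : ∀ a b p q → (a - (a - b) * p) - (b - (a - b) * q) ≡ (a - b) - (a - b) * (p - q)
        l = solve-∀ ringℚ
        l′ : ∀ k → k - k * 1ℚ ≡ 0ℚ
        l′ = solve-∀ ringℚ
      -- Of the edges of `T`, only sides `i` and `after i` meet this corner, and side `i` is already
      -- settled.
      step : ∀ i → K (side T i) ≡ K (rev (side T i)) → K (side T (after i)) ≡ K (rev (side T (after i)))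
      step i e = lone-edge K K-face (side T (after i)) others
        where
        others : ∀ d → org d ≡ corner T (after i) → d ≢ side T (after i) → K d ≡ K (rev d)
        others d od d≢ with on? T d
        ... | no off = K-off off
        ... | yes (j , inj₁ refl) = ⊥-elim (d≢ (cong (side T) (corner-injective T od)))
        ... | yes (j , inj₂ e′) = subst (λ d → K d ≡ K (rev d)) (rev-swap e′)
            (K-rev (subst (λ j → K (side T j) ≡ K (rev (side T j))) (after-injective (corner-injective T (trans (sym od) (trans (sym (cong org (rev-swap e′))) (link T j))))) e))
      K-side : ∀ i → K (side T i) ≡ K (rev (side T i))
      K-side zero             = K₀
      K-side (suc zero)       = step zero K₀
      K-side (suc (suc zero)) = step (suc zero) (step zero K₀)
      K-edge : ∀ d → K d ≡ K (rev d)
      K-edge d with on? T d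
      ... | no off = K-off off
      ... | yes (i , inj₁ refl) = K-side i
      ... | yes (i , inj₂ e) = subst (λ d → K d ≡ K (rev d)) (rev-swap e) (K-rev (K-side i))

    -- Jordan curve: f² is also a potential supported on the triangle, so f² = k f.
    abstract
      square : ∃ λ k → ∀ d → f d * f d ≡ k * f d
      square = potential-unique (λ d → f d * f d) (λ d → cong (λ x → x * x) (f-face d))
        (λ u r → cong (λ x → x * x) (f-root u r)) (λ d off → cong (λ x → x * x) (f-off off))

    level : ℚ
    level = proj₁ square

    f-values : ∀ d → f d ≡ 0ℚ ⊎ f d ≡ level
    f-values d = [ inj₁ , inj₂ ∘ minus-zero ]′
      (*-zero-cases (f d) (f d - level) (trans (l (f d) level) (trans (cong (λ x → x - level * f d) (proj₂ square d)) (ℚ.+-inverseʳ (level * f d)))))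
      where
      l : ∀ a k → a * (a - k) ≡ a * a - k * a
      l = solve-∀ ringℚ

    nonzero : ℚ → Bool
    nonzero x = not (does (x ℚ.≟ 0ℚ))

    nonzero-true : ∀ {x} → nonzero x ≡ true → x ≢ 0ℚ
    nonzero-true {x} h with x ℚ.≟ 0ℚ
    ... | no x≢0 = x≢0

    nonzero-false : ∀ {x} → nonzero x ≡ false → x ≡ 0ℚ
    nonzero-false {x} h with x ℚ.≟ 0ℚ
    ... | yes e = e

    inside : Dart → Bool
    inside d = nonzero (f d)

    inside-level : ∀ {d} → inside d ≡ true → f d ≡ level
    inside-level {d} h = [ (λ e → ⊥-elim (nonzero-true h e)) , id ]′ (f-values d)

    -- The potential jumps across an edge of `T`, so it is neither 0 on both sides nor `level` on
    -- both.
    inside-on : ∀ {d} → On T d → inside (rev d) ≡ not (inside d)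
    inside-on {d} o = by-cases (inside d)
      (λ e → by-cases (inside (rev d))
        (λ e′ → ⊥-elim (t-on o (trans (sym (f-edge d)) (trans (cong₂ _-_ (inside-level e) (inside-level e′)) (ℚ.+-inverseʳ level)))))
        (λ e′ → trans e′ (cong not (sym e))))
      (λ e → by-cases (inside (rev d))
        (λ e′ → trans e′ (cong not (sym e)))
        (λ e′ → ⊥-elim (t-on o (trans (sym (f-edge d)) (cong₂ _-_ (nonzero-false {f d} e) (nonzero-false {f (rev d)} e′))))))

    multiple-cases : ∀ b x k → [ b ] ≡ k * x → k ≡ 0ℚ × b ≡ false ⊎ b ≡ nonzero x
    multiple-cases b x k e with k ℚ.≟ 0ℚ | b | x ℚ.≟ 0ℚ
    ... | yes refl | true  | _ = ⊥-elim (1ℚ≢0ℚ (trans e (ℚ.*-zeroˡ x)))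
    ... | yes refl | false | _ = inj₁ (refl , refl)
    ... | no _ | true  | no _ = inj₂ refl
    ... | no _ | true  | yes refl = ⊥-elim (1ℚ≢0ℚ (trans e (ℚ.*-zeroʳ k)))
    ... | no _ | false | yes _ = inj₂ refl
    ... | no k≢0 | false | no x≢0 = ⊥-elim ([ k≢0 , x≢0 ]′ (*-zero-cases k x (sym e)))

    -- The indicator of `J` is `k * f`: it is empty if `k = 0` and has the support of `f` otherwise.
    -- This plays the role of connectedness of the inside.
    inside-unique : ∀ (J : Dart → Bool) → FaceConstant J → AtRoots J false → (∀ d → ¬ On T d → J d ≡ J (rev d)) →
      (∀ d → J d ≡ false) ⊎ (∀ d → J d ≡ inside d)
    inside-unique J Jf Jr Joff =
      let k , e = potential-unique (λ d → [ J d ]) (λ d → cong [_] (Jf d)) (λ u r → cong [_] (Jr u r)) (λ d off → cong [_] (Joff d off))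
      in decide k e (k ℚ.≟ 0ℚ)
      where
      decide : ∀ k → (∀ d → [ J d ] ≡ k * f d) → Dec (k ≡ 0ℚ) → (∀ d → J d ≡ false) ⊎ (∀ d → J d ≡ inside d)
      decide k e (yes refl) = inj₁ λ d → is-false (trans (e d) (ℚ.*-zeroˡ (f d)))
        where
        is-false : ∀ {b} → [ b ] ≡ 0ℚ → b ≡ false
        is-false {false} _ = refl
      decide k e (no k≢0) = inj₂ λ d → [ (λ { (k≡0 , _) → ⊥-elim (k≢0 k≡0) }) , id ]′ (multiple-cases (J d) (f d) k (e d))

  -- All that the combinatorial part uses about the inside; the rational potential is forgotten from
  -- here on.
  record Enclosed (T : Triangle) : Set where
    field
      inside        : Dart → Bool
      inside-face   : FaceConstant inside
      inside-root   : AtRoots inside false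
      inside-off    : ∀ {d} → ¬ On T d → inside d ≡ inside (rev d)
      inside-on     : ∀ {d} → On T d → inside (rev d) ≡ not (inside d)
      inside-unique : ∀ (J : Dart → Bool) → FaceConstant J → AtRoots J false → (∀ d → ¬ On T d → J d ≡ J (rev d)) →
        (∀ d → J d ≡ false) ⊎ (∀ d → J d ≡ inside d)

  abstract
    enclosed : ∀ T → Enclosed T
    enclosed T = record
      { inside = inside
      ; inside-face = λ d → cong nonzero (f-face d)
      ; inside-root = λ u r → cong nonzero (f-root u r)
      ; inside-off = λ off → cong nonzero (f-off off)
      ; inside-on = inside-on
      ; inside-unique = inside-unique
      }
      where open Boundary T

-- Nested and disjoint triangles

module Nesting {n : ℕ} {G : SimpleGraph n} (R : RotationSystem G)
  (euler : 2 ℕ.* (vertexCount R ℕ.+ faceCount R) ≡ m R ℕ.+ 4 ℕ.* nontrivialComponents G) where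

  open Embedding R euler
  open Regions R euler
  open Triangle

  inside : Triangle → Dart → Bool
  inside T = Enclosed.inside (enclosed T)

  size : Triangle → ℕ
  size T = countF (inside T)

  Corner : Triangle → Fin n → Set
  Corner T u = ∃ λ i → u ≡ corner T i

  corner? : ∀ T u → Dec (Corner T u)
  corner? T u = Fin.any? (λ i → u Fin.≟ corner T i)

  inside-off : ∀ T {d} → ¬ On T d → inside T d ≡ inside T (rev d)
  inside-off T = Enclosed.inside-off (enclosed T)

  inside-on : ∀ T {d} → On T d → inside T (rev d) ≡ not (inside T d)
  inside-on T = Enclosed.inside-on (enclosed T)

  -- No dart at such a vertex is on `T`, and `rot x` lies in the face of `rev x`, so turning around
  -- the vertex never crosses `T`.
  inside-around : ∀ T {d e} → ¬ Corner T (org d) → org d ≡ org e → inside T d ≡ inside T e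
  inside-around T {d} {e} nc oe =
    let k , ke = σ-cyclic R d e oe in trans (sym (go k)) (cong (inside T) ke)
    where
    step : ∀ x → ¬ Corner T (org x) → inside T (rot x) ≡ inside T x
    step x ncx = trans (cong (inside T ∘ rot) (sym (rev-rev x)))
      (trans (Enclosed.inside-face (enclosed T) (rev x)) (sym (inside-off T (ncx ∘ On-corner T))))
    go : ∀ k → inside T (iter rot k d) ≡ inside T d
    go zero    = refl
    go (suc k) = trans (step (iter rot k d) (nc ∘ subst (Corner T) (iter-invariant rot org (σ-tail R) k d))) (go k)

  -- Consecutive edges of T′ off T are on the same side of T: either their common corner is not
  -- on T, or the other two corners of T′ are not.
  module SameSide (T T′ : Triangle) where

    x : Fin 3 → Dart
    x = side T′

    turn : ∀ i → ¬ On T (x i) → ¬ Corner T (corner T′ (after i)) → inside T (x i) ≡ inside T (x (after i))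
    turn i off nc = trans (inside-off T off) (inside-around T (nc ∘ subst (Corner T) (link T′ i)) (link T′ i))

    consecutive : ∀ i → ¬ On T (x i) → ¬ On T (x (after i)) → inside T (x i) ≡ inside T (x (after i))
    consecutive i off off′ with corner? T (corner T′ (after i))
    ... | no nc = turn i off nc
    ... | yes (k , e) = sym (trans (turn (after i) off′ nc₂)
          (trans (turn (after (after i)) (nc₂ ∘ On-corner T) (subst (λ j → ¬ Corner T (corner T′ j)) (sym (thrice i)) nc₀))
                 (cong (inside T ∘ x) (thrice i))))
      where
      nc₀ : ¬ Corner T (corner T′ i)
      nc₀ (j , e′) = off (chord-On T (x i) j k e′ (trans (link T′ i) e))
      nc₂ : ¬ Corner T (corner T′ (after (after i)))
      nc₂ (j , e′) = off′ (chord-On T (x (after i)) k j e (trans (link T′ (after i)) e′))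

    sides : ∀ i j → ¬ On T (x i) → ¬ On T (x j) → inside T (x i) ≡ inside T (x j)
    sides i j offᵢ offⱼ with after-cases i j
    ... | inj₁ refl = refl
    ... | inj₂ (inj₁ refl) = consecutive i offᵢ offⱼ
    ... | inj₂ (inj₂ refl) = sym (consecutive j offⱼ offᵢ)

    to-side : ∀ {d} → On T′ d → ¬ On T d → ∃ λ i → ¬ On T (x i) × inside T d ≡ inside T (x i)
    to-side (i , inj₁ refl) off = i , off , refl
    to-side (i , inj₂ e) off = i , (off ∘ On-rev⁻ T ∘ subst (On T) (sym e)) , trans (inside-off T off) (cong (inside T) e)

    same-side : ∀ {d e} → On T′ d → ¬ On T d → On T′ e → ¬ On T e → inside T d ≡ inside T e
    same-side od offd oe offe =
      let i , offᵢ , ei = to-side od offd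
          j , offⱼ , ej = to-side oe offe
      in trans ei (trans (sides i j offᵢ offⱼ) (sym ej))

  open SameSide using (same-side)

  _⊑_ : Triangle → Triangle → Set
  T′ ⊑ T = ∀ d → inside T′ d ≡ true → inside T d ≡ true

  Disjoint : Triangle → Triangle → Set
  Disjoint T T′ = ∀ d → inside T d ≡ true → inside T′ d ≡ false

  module Compare (T T′ : Triangle) where

    I I′ : Dart → Bool
    I  = inside T
    I′ = inside T′

    -- If the edges of `T′` off `T` do not border the combined region, its border lies on `T`, and
    -- minimality of the inside leaves two cases.
    combine : (op : Bool → Bool → Bool) → op false false ≡ false →
      (∀ {d} → On T′ d → ¬ On T d → op (I d) (I′ d) ≡ op (I (rev d)) (I′ (rev d))) →
      (∀ d → op (I d) (I′ d) ≡ false) ⊎ (∀ d → op (I d) (I′ d) ≡ I d)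
    combine op e h = Enclosed.inside-unique (enclosed T) (λ d → op (I d) (I′ d))
      (λ d → cong₂ op (Enclosed.inside-face (enclosed T) d) (Enclosed.inside-face (enclosed T′) d))
      (λ u r → trans (cong₂ op (Enclosed.inside-root (enclosed T) u r) (Enclosed.inside-root (enclosed T′) u r)) e)
      off
      where
      off : ∀ d → ¬ On T d → op (I d) (I′ d) ≡ op (I (rev d)) (I′ (rev d))
      off d od with on? T′ d
      ... | yes o′ = h o′ od
      ... | no o′ = cong₂ op (inside-off T od) (inside-off T′ o′)

    -- Combine to the part of the inside of `T′` that is outside `T`. Outside `T`, both alternatives
    -- make `I′` false.
    all-inside : (∀ {d} → On T′ d → ¬ On T d → I d ≡ true) → T′ ⊑ T
    all-inside h d e = by-cases (I d) id λ ne →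
      ⊥-elim (true≢false (cong₂ (λ a b → not a ∧ b) ne e) ([ (λ f → f d) , (λ f → trans (f d) ne) ]′ J))
      where
      J = combine (λ a b → not a ∧ b) refl
        (λ {d} o off → trans (cong (λ a → not a ∧ I′ d) (h o off))
          (sym (cong (λ a → not a ∧ I′ (rev d)) (trans (sym (inside-off T off)) (h o off)))))

    -- The intersection of the two insides is empty or the whole inside of `T`.
    all-outside : (∀ {d} → On T′ d → ¬ On T d → I d ≡ false) → Disjoint T T′ ⊎ T ⊑ T′
    all-outside h = [ (λ f → inj₁ λ d e → ∧-false (f d) e) , (λ f → inj₂ λ d e → proj₂ (∧-true {I d} (trans (f d) e))) ]′
      (combine _∧_ refl (λ {d} o off → trans (cong (_∧ I′ d) (h o off)) (sym (cong (_∧ I′ (rev d)) (trans (sym (inside-off T off)) (h o off))))))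

    nested : ∀ {d} → On T′ d → ¬ On T d → I d ≡ true → T′ ⊑ T
    nested o off e = all-inside λ o′ off′ → trans (same-side T T′ o′ off′ o off) e

    -- Both sides of the edge are inside `T` but only one is inside `T′`, so the inclusion is
    -- strict. Hence an edge strictly inside `T` lies only on smaller triangles.
    size-nested : ∀ {d} → On T′ d → ¬ On T d → I d ≡ true → size T′ ℕ.< size T
    size-nested {d} o off e = by-cases (I′ d)
      (λ e′ → countF-strict I′ I (nested o off e) (rev d) (trans (inside-on T′ o) (cong not e′)) (trans (sym (inside-off T off)) e))
      (λ e′ → countF-strict I′ I (nested o off e) d e′ e)

    -- Some side of `T′` off `T` decides the case for all of them; if every side of `T′` is on `T`,
    -- then `all-inside` holds vacuously.
    compare : T′ ⊑ T ⊎ Disjoint T T′ ⊎ T ⊑ T′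
    compare = decide (Fin.any? (λ i → ¬? (on? T (side T′ i))))
      where
      decide : Dec (∃ λ i → ¬ On T (side T′ i)) → T′ ⊑ T ⊎ Disjoint T T′ ⊎ T ⊑ T′
      decide (no none) = inj₁ (all-inside λ o off → let i , offᵢ , _ = SameSide.to-side T T′ o off in ⊥-elim (none (i , offᵢ)))
      decide (yes (i , off)) = by-cases (I (side T′ i))
        (λ e → inj₁ (nested (i , inj₁ refl) off e))
        (λ e → inj₂ (all-outside λ o′ off′ → trans (same-side T T′ o′ off′ (i , inj₁ refl) off) e))

  open Compare public using (compare; size-nested)

-- Rounding to half-integers

_≡?_ : ℚ → ℚ → Bool
x ≡? y = does (x ℚ.≟ y)

≡?-true : ∀ {x y} → x ≡ y → (x ≡? y) ≡ true
≡?-true {x} {y} = dec-true (x ℚ.≟ y)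

≡?-false : ∀ {x y} → x ≢ y → (x ≡? y) ≡ false
≡?-false {x} {y} = dec-false (x ℚ.≟ y)

≡?⇒≡ : ∀ {x y} → (x ≡? y) ≡ true → x ≡ y
≡?⇒≡ {x} {y} h with x ℚ.≟ y
... | yes e = e

-- Representatives in [0,1) of the classes modulo 1 of the numbers in [0,1].
fract : ℚ → ℚ
fract y = if y ≡? 1ℚ then 0ℚ else y

fract-other : ∀ {y} → y ≢ 1ℚ → fract y ≡ y
fract-other {y} h = cong (λ b → if b then 0ℚ else y) (≡?-false h)

neg : ℚ → ℚ
neg z = fract (1ℚ - z)

one-minus-one-minus : ∀ y → 1ℚ - (1ℚ - y) ≡ y
one-minus-one-minus = solve-∀ ringℚ

neg-fract : ∀ y → neg (fract y) ≡ fract (1ℚ - y)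
neg-fract y with y ℚ.≟ 1ℚ
... | yes refl = refl
... | no _ = refl

neg-neg : ∀ y → neg (neg (fract y)) ≡ fract y
neg-neg y = trans (cong neg (neg-fract y)) (trans (neg-fract (1ℚ - y)) (cong fract (one-minus-one-minus y)))

HalfInteger : ℚ → Set
HalfInteger x = x ≡ 0ℚ ⊎ x ≡ 1ℚ ⊎ x ≡ ½

-- The middle value ½ is the fixed point of `y ↦ 1 - y`, which makes rounding compatible with
-- complements.
round : ℚ → ℚ
round y = if y ≡? 0ℚ then 0ℚ else if y ≡? 1ℚ then 1ℚ else ½

round-other : ∀ {y} → y ≢ 0ℚ → y ≢ 1ℚ → round y ≡ ½
round-other {y} h h′ = cong₂ (λ a b → if a then 0ℚ else if b then 1ℚ else ½) (≡?-false h) (≡?-false h′)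

round-complement : ∀ y → round y + round (1ℚ - y) ≡ 1ℚ
round-complement y with y ℚ.≟ 0ℚ
... | yes refl = refl
... | no y≢0 with y ℚ.≟ 1ℚ
... | yes refl = refl
... | no y≢1 = cong (½ +_) (round-other {1ℚ - y}
      (λ e → y≢1 (trans (sym (one-minus-one-minus y)) (cong (λ z → 1ℚ - z) e)))
      (λ e → y≢0 (trans (sym (one-minus-one-minus y)) (cong (λ z → 1ℚ - z) e))))

round-complement′ : ∀ {x y} → x + y ≡ 1ℚ → round x + round y ≡ 1ℚ
round-complement′ {x} {y} e = trans (cong (λ z → round x + round z) (trans (l x y) (cong (_- x) e))) (round-complement x)
  where
  l : ∀ x y → y ≡ (x + y) - x
  l = solve-∀ ringℚ

round-HalfInteger : ∀ y → HalfInteger (round y)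
round-HalfInteger y with y ℚ.≟ 0ℚ
... | yes _ = inj₁ refl
... | no _ with y ℚ.≟ 1ℚ
... | yes _ = inj₂ (inj₁ refl)
... | no _  = inj₂ (inj₂ refl)

nonneg-sum-zero : ∀ {a b} → 0ℚ ≤ a → 0ℚ ≤ b → a + b ≡ 0ℚ → a ≡ 0ℚ
nonneg-sum-zero {a} 0≤a 0≤b e = ℚ.≤-antisym (subst (a ≤_) e (a≤a+b 0≤b)) 0≤a

no-room : ∀ {w} → 0ℚ ≤ w → 1ℚ + w ≤ 1ℚ → w ≡ 0ℚ
no-room {w} 0≤w h = ℚ.≤-antisym (subst₂ _≤_ (l w) (ℚ.+-inverseʳ 1ℚ) (ℚ.+-monoˡ-≤ (- 1ℚ) h)) 0≤w
  where
  l : ∀ w → (1ℚ + w) + - 1ℚ ≡ w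
  l = solve-∀ ringℚ

-- From 0 the increment is a rounded value, and from 1 there is no room. Otherwise it is ½ if the
-- sum reaches 1, and 0 if not.
increment-HalfInteger : ∀ {y w} → 0ℚ ≤ y → 0ℚ ≤ w → y + w ≤ 1ℚ → HalfInteger (round (y + w) - round y)
increment-HalfInteger {y} {w} 0≤y 0≤w le with y ℚ.≟ 0ℚ
... | yes refl = subst HalfInteger (l (round (0ℚ + w))) (round-HalfInteger (0ℚ + w))
  where
  l : ∀ a → a ≡ a - 0ℚ
  l = solve-∀ ringℚ
... | no y≢0 with y ℚ.≟ 1ℚ
... | yes refl = inj₁ (trans (cong (λ w → round (1ℚ + w) - 1ℚ) (no-room 0≤w le)) refl)
... | no y≢1 with y + w ℚ.≟ 0ℚ
... | yes e = ⊥-elim (y≢0 (nonneg-sum-zero 0≤y 0≤w e))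
... | no _ with y + w ℚ.≟ 1ℚ
... | yes _ = inj₂ (inj₂ refl)
... | no _  = inj₁ refl

-- If `w` is positive, neither `y` nor `y′` is 1, so equal classes mean equal numbers; if `w = 0`,
-- nothing changes.
same-increment : ∀ {y y′ w} → 0ℚ ≤ w → y + w ≤ 1ℚ → y′ + w ≤ 1ℚ → fract y ≡ fract y′ →
  fract (y + w) ≡ fract (y′ + w) × round (y + w) ≡ round y + (round (y′ + w) - round y′)
same-increment {y} {y′} {w} 0≤w le le′ e = decide (w ℚ.≟ 0ℚ)
  where
  l : ∀ a b → a ≡ a + (b - b)
  l = solve-∀ ringℚ
  l′ : ∀ a b → a ≡ b + (a - b)
  l′ = solve-∀ ringℚ
  decide : Dec (w ≡ 0ℚ) → _
  decide (yes refl) = trans (cong fract (ℚ.+-identityʳ y)) (trans e (cong fract (sym (ℚ.+-identityʳ y′)))) ,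
    trans (cong round (ℚ.+-identityʳ y)) (trans (l (round y) (round y′)) (cong (λ x → round y + (round x - round y′)) (sym (ℚ.+-identityʳ y′))))
  decide (no w≢0) = cong (λ y → fract (y + w)) y≡y′ , trans (l′ (round (y + w)) (round y)) (cong (λ z → round y + (round (z + w) - round z)) y≡y′)
    where
    not-one : ∀ {x} → x + w ≤ 1ℚ → x ≢ 1ℚ
    not-one le refl = w≢0 (no-room 0≤w le)
    y≡y′ : y ≡ y′
    y≡y′ = trans (sym (fract-other (not-one le))) (trans e (fract-other (not-one le′)))

-- Divisibility by three of rational integers

fromℕ : ℕ → ℚ
fromℕ zero    = 0ℚ
fromℕ (suc k) = 1ℚ + fromℕ k

fromℕ-nonneg : ∀ k → 0ℚ ≤ fromℕ k
fromℕ-nonneg zero    = ℚ.≤-refl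
fromℕ-nonneg (suc k) = +-nonneg (ℚ.nonNegative⁻¹ 1ℚ) (fromℕ-nonneg k)

fromℕ-+ : ∀ j k → fromℕ (j ℕ.+ k) ≡ fromℕ j + fromℕ k
fromℕ-+ zero    k = sym (ℚ.+-identityˡ (fromℕ k))
fromℕ-+ (suc j) k = trans (cong (1ℚ +_) (fromℕ-+ j k)) (sym (ℚ.+-assoc 1ℚ (fromℕ j) (fromℕ k)))

fromℕ-suc≢0 : ∀ k → fromℕ (suc k) ≢ 0ℚ
fromℕ-suc≢0 k e = 1ℚ≢0ℚ (nonneg-sum-zero (ℚ.nonNegative⁻¹ 1ℚ) (fromℕ-nonneg k) e)

fromℕ-injective : ∀ j k → fromℕ j ≡ fromℕ k → j ≡ k
fromℕ-injective zero    zero    e = refl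
fromℕ-injective zero    (suc k) e = ⊥-elim (fromℕ-suc≢0 k (sym e))
fromℕ-injective (suc j) zero    e = ⊥-elim (fromℕ-suc≢0 j e)
fromℕ-injective (suc j) (suc k) e = cong suc (fromℕ-injective j k (trans (l (fromℕ j)) (trans (cong (_- 1ℚ) e) (sym (l (fromℕ k))))))
  where
  l : ∀ a → a ≡ (1ℚ + a) - 1ℚ
  l = solve-∀ ringℚ

-- A difference of two natural multiples of three: it covers negative values while the sums stay in
-- ℚ.
Div3 : ℚ → Set
Div3 q = ∃ λ a → ∃ λ b → q + fromℕ (b ℕ.* 3) ≡ fromℕ (a ℕ.* 3)

Div3-0 : Div3 0ℚ
Div3-0 = 0 , 0 , refl

Div3-neg : ∀ {q} → Div3 q → Div3 (- q)
Div3-neg {q} (a , b , e) = b , a , trans (cong (- q +_) (sym e)) (l q (fromℕ (b ℕ.* 3)))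
  where
  l : ∀ q b → - q + (q + b) ≡ b
  l = solve-∀ ringℚ

Div3-+ : ∀ {p q} → Div3 p → Div3 q → Div3 (p + q)
Div3-+ {p} {q} (a , b , e) (a′ , b′ , e′) = a ℕ.+ a′ , b ℕ.+ b′ ,
  trans (cong ((p + q) +_) (split b b′)) (trans (l p q (fromℕ (b ℕ.* 3)) (fromℕ (b′ ℕ.* 3))) (trans (cong₂ _+_ e e′) (sym (split a a′))))
  where
  split : ∀ a b → fromℕ ((a ℕ.+ b) ℕ.* 3) ≡ fromℕ (a ℕ.* 3) + fromℕ (b ℕ.* 3)
  split a b = trans (cong fromℕ (ℕ.*-distribʳ-+ 3 a b)) (fromℕ-+ (a ℕ.* 3) (b ℕ.* 3))
  l : ∀ p q b c → (p + q) + (b + c) ≡ (p + b) + (q + c)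
  l = solve-∀ ringℚ

¬Div3-1 : ¬ Div3 1ℚ
¬Div3-1 (a , b , e) = absurd a b (fromℕ-injective (suc (b ℕ.* 3)) (a ℕ.* 3) e)
  where
  absurd : ∀ a b → suc (b ℕ.* 3) ≡ a ℕ.* 3 → ⊥
  absurd (suc a) (suc b) e = absurd a b (ℕ.suc-injective (ℕ.suc-injective (ℕ.suc-injective e)))

-- Odd under negation modulo 1: it is 1 at the class `x`, -1 at its negative, and 0 everywhere if
-- the two coincide.
sign : ℚ → ℚ → ℚ
sign x z = [ z ≡? x ] - [ neg z ≡? x ]

Div3-sign : ∀ x z → Div3 (sign x z + (sign x z + (sign x z + 0ℚ)))
Div3-sign x z with z ≡? x | neg z ≡? x
... | true  | true  = 0 , 0 , refl
... | false | false = 0 , 0 , refl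
... | true  | false = 1 , 0 , refl
... | false | true  = 0 , 1 , refl

sign-neg : ∀ x {z z′} → z′ ≡ neg z → z ≡ neg z′ → sign x z + sign x z′ ≡ 0ℚ
sign-neg x {z} {z′} e e′ = trans (cong₂ (λ a b → ([ z ≡? x ] - [ a ≡? x ]) + ([ z′ ≡? x ] - [ b ≡? x ])) (sym e) (sym e′)) (l [ z ≡? x ] [ z′ ≡? x ])
  where
  l : ∀ a b → (a - b) + (b - a) ≡ 0ℚ
  l = solve-∀ ringℚ

-- Unless the class is its own negative, the three signs are ±1 with first sign 1. Their sum is 3, 1
-- or -1, and only 3 is divisible by three.
sign-equal : ∀ y (z : Fin 3 → ℚ) → z zero ≡ fract y → (∀ i → z i ≡ fract y ⊎ z i ≡ neg (fract y)) →
  Div3 (sum (λ i → sign (fract y) (z i))) → ∀ i → z i ≡ fract y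
sign-equal y z e₀ cases div with neg (fract y) ℚ.≟ fract y
... | yes ne = λ i → [ id , (λ e → trans e ne) ]′ (cases i)
... | no ne = λ
  { zero → e₀
  ; (suc zero) → [ id , (λ e₁ → ⊥-elim (bad₁ e₁)) ]′ (cases (suc zero))
  ; (suc (suc zero)) → [ id , (λ e₂ → ⊥-elim (bad₂ e₂)) ]′ (cases (suc (suc zero))) }
  where
  x = fract y
  plus : ∀ {z} → z ≡ x → sign x z ≡ 1ℚ
  plus refl = cong₂ (λ a b → [ a ] - [ b ]) (≡?-true {x} refl) (≡?-false ne)
  minus : ∀ {z} → z ≡ neg x → sign x z ≡ - 1ℚ
  minus refl = cong₂ (λ a b → [ a ] - [ b ]) (≡?-false ne) (≡?-true (neg-neg y))
  total : ∀ {a b c} → sign x (z zero) ≡ a → sign x (z (suc zero)) ≡ b → sign x (z (suc (suc zero))) ≡ c → Div3 (a + (b + (c + 0ℚ)))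
  total refl refl refl = div
  bad₁ : z (suc zero) ≡ neg x → ⊥
  bad₁ e₁ = [ (λ e₂ → ¬Div3-1 (total (plus e₀) (minus e₁) (plus e₂)))
            , (λ e₂ → ¬Div3-1 (Div3-neg { - 1ℚ} (total (plus e₀) (minus e₁) (minus e₂)))) ]′ (cases (suc (suc zero)))
  bad₂ : z (suc (suc zero)) ≡ neg x → ⊥
  bad₂ e₂ = [ (λ e₁ → ¬Div3-1 (total (plus e₀) (plus e₁) (minus e₂)))
            , (λ e₁ → ¬Div3-1 (Div3-neg { - 1ℚ} (total (plus e₀) (minus e₁) (minus e₂)))) ]′ (cases (suc zero))

-- Treating the triangles by increasing size

does-true : ∀ {A : Set} (a? : Dec A) → does a? ≡ true → A
does-true (yes a) _ = a

sum-swap : ∀ {k m} (f : Fin k → Fin m → ℚ) → sum (λ d → sum (λ i → f i d)) ≡ sum (λ i → sum (f i))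
sum-swap {zero} {m} f = sum-zero {m} (λ _ → 0ℚ) (λ _ → refl)
sum-swap {suc k} f = trans (sum-+ (f zero) (λ d → sum (λ i → f (suc i) d))) (cong (sum (f zero) +_) (sum-swap (f ∘ suc)))

sum-*ʳ : ∀ {m} (f : Fin m → ℚ) c → sum (λ i → f i * c) ≡ sum f * c
sum-*ʳ f c = trans (sum-cong (λ i → ℚ.*-comm (f i) c)) (trans (sym (*-distribˡ-sum c f)) (ℚ.*-comm c (sum f)))

double-zero : ∀ {s} → s + s ≡ 0ℚ → s ≡ 0ℚ
double-zero {s} e = trans (l s) (cong (½ *_) e)
  where
  l : ∀ s → s ≡ ½ * (s + s)
  l = solve-∀ ringℚ

module Rounding {n : ℕ} {G : SimpleGraph n} (R : RotationSystem G)
  (euler : 2 ℕ.* (vertexCount R ℕ.+ faceCount R) ≡ m R ℕ.+ 4 ℕ.* nontrivialComponents G) where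

  open Embedding R euler
  open Regions R euler
  open Nesting R euler
  open Triangle

  abstract
    on : Triangle → Dart → Bool
    on T d = does (on? T d)

    on-true : ∀ T {d} → On T d → on T d ≡ true
    on-true T {d} = dec-true (on? T d)

    on-false : ∀ T {d} → ¬ On T d → on T d ≡ false
    on-false T {d} = dec-false (on? T d)

    on-On : ∀ T {d} → on T d ≡ true → On T d
    on-On T {d} e = does-true (on? T d) e

  on-off : ∀ T {d} → on T d ≡ false → ¬ On T d
  on-off T e o = true≢false (on-true T o) e

  on-rev : ∀ T d → on T (rev d) ≡ on T d
  on-rev T d = by-cases (on T d)
    (λ e → trans (on-true T (On-rev T (on-On T e))) (sym e))
    (λ e → trans (on-false T (on-off T e ∘ On-rev⁻ T)) (sym e))

  -- Of the two darts of a side, the one whose face is inside.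
  inner : Triangle → Fin 3 → Dart
  inner T i = if inside T (side T i) then side T i else rev (side T i)

  module Inner (T : Triangle) where

    x : Fin 3 → Dart
    x = side T

    x-On : ∀ i → On T (x i)
    x-On i = i , inj₁ refl

    inner-true : ∀ {i} → inside T (x i) ≡ true → inner T i ≡ x i
    inner-true {i} e = cong (λ b → if b then x i else rev (x i)) e

    inner-false : ∀ {i} → inside T (x i) ≡ false → inner T i ≡ rev (x i)
    inner-false {i} e = cong (λ b → if b then x i else rev (x i)) e

    inner-cases : ∀ i → inner T i ≡ x i ⊎ inner T i ≡ rev (x i)
    inner-cases i = by-cases (inside T (x i)) (inj₁ ∘ inner-true) (inj₂ ∘ inner-false)

    inner-On : ∀ i → On T (inner T i)
    inner-On i = [ (λ e → subst (On T) (sym e) (x-On i)) , (λ e → subst (On T) (sym e) (On-rev T (x-On i))) ]′ (inner-cases i)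

    inner-inside : ∀ i → inside T (inner T i) ≡ true
    inner-inside i = by-cases (inside T (x i))
      (λ e → trans (cong (inside T) (inner-true e)) e)
      (λ e → trans (cong (inside T) (inner-false e)) (trans (inside-on T (x-On i)) (cong not e)))

    inner-injective : ∀ {i j} → inner T i ≡ inner T j → i ≡ j
    inner-injective {i} {j} e =
      [ (λ eᵢ → [ (λ eⱼ → side-injective T (trans (sym eᵢ) (trans e eⱼ)))
                , (λ eⱼ → ⊥-elim (side-rev T j i (trans (sym eⱼ) (trans (sym e) eᵢ)))) ]′ (inner-cases j))
      , (λ eᵢ → [ (λ eⱼ → ⊥-elim (side-rev T i j (trans (sym eᵢ) (trans e eⱼ))))
                , (λ eⱼ → side-injective T (rev-injective (trans (sym eᵢ) (trans e eⱼ)))) ]′ (inner-cases j)) ]′ (inner-cases i)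

    inner-complete : ∀ {d} → On T d → inside T d ≡ true → ∃ λ i → d ≡ inner T i
    inner-complete {d} (i , inj₁ e) I = i , trans e (sym (inner-true (trans (cong (inside T) (sym e)) I)))
    inner-complete {d} (i , inj₂ e) I = i , trans (sym (rev-swap e))
      (sym (inner-false (trans (cong (inside T) (sym e)) (trans (inside-on T (i , inj₂ e)) (cong not I)))))

    indicator : ∀ d → [ inside T d ∧ on T d ] ≡ sum (λ i → [ d == inner T i ])
    indicator d = by-cases (inside T d ∧ on T d)
      (λ e → let I , o = ∧-true {inside T d} e
                 i , di = inner-complete (on-On T o) I
             in trans (cong [_] e) (sym (trans
               (sum-single (λ j → [ d == inner T j ]) i (λ j j≢i → cong [_] (==-false (λ dj → j≢i (inner-injective (trans (sym dj) di))))))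
               (cong [_] (==-true di)))))
      (λ e → trans (cong [_] e) (sym (sum-zero (λ j → [ d == inner T j ]) (λ j → cong [_] (==-false (λ dj →
        true≢false (trans (cong (λ d → inside T d ∧ on T d) dj) (cong₂ _∧_ (inner-inside j) (on-true T (inner-On j)))) e))))))

    sum-inner : ∀ (h : Dart → ℚ) → sum (λ d → [ inside T d ∧ on T d ] * h d) ≡ sum (λ i → h (inner T i))
    sum-inner h = begin
      sum (λ d → [ inside T d ∧ on T d ] * h d)
        ≡⟨ sum-cong (λ d → trans (cong (_* h d) (indicator d)) (sym (sum-*ʳ (λ i → [ d == inner T i ]) (h d)))) ⟩
      sum (λ d → sum (λ i → [ d == inner T i ] * h d)) ≡⟨ sum-swap (λ i d → [ d == inner T i ] * h d) ⟩
      sum (λ i → sum (λ d → [ d == inner T i ] * h d)) ≡⟨ sum-cong (λ i → sum-== (inner T i) h) ⟩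
      sum (λ i → h (inner T i)) ∎
      where open ≡-Reasoning

  sum-cancel : ∀ (F : Dart → ℚ) → (∀ d → F d + F (rev d) ≡ 0ℚ) → sum F ≡ 0ℚ
  sum-cancel F h = double-zero (trans (cong (sum F +_) (sym (sum-rev F))) (trans (sym (sum-+ F (F ∘ rev))) (sum-zero (λ d → F d + F (rev d)) h)))

  Weighted : Set
  Weighted = Triangle × ℚ

  load : List Weighted → Dart → ℚ
  load []            d = 0ℚ
  load ((T , w) ∷ L) d = [ on T d ] * w + load L d

  signSum : (Dart → Bool) → (Dart → ℚ) → ℚ → Triangle → ℚ
  signSum hid Z x T = sum (λ d → [ inside T d ∧ not (hid d) ] * sign x (Z d))

  -- L lists the triangles that are still to be treated.  Y d is the weight that the treated
  -- triangles put on the edge of d from the side of d.  The edges strictly inside a treated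
  -- triangle are hidden, which merges faces; Z is the fractional part of Y, as a function
  -- of the merged faces.
  record State (L : List Weighted) : Set where
    field
      hid      : Dart → Bool
      Z Y      : Dart → ℚ
      hid-rev  : ∀ d → hid (rev d) ≡ hid d
      Z-face   : FaceConstant Z
      Z-hid    : ∀ d → hid d ≡ true → Z d ≡ Z (rev d)
      Z-Y      : ∀ d → hid d ≡ false → Z d ≡ fract (Y d)
      Y-nonneg : ∀ d → 0ℚ ≤ Y d
      visible  : All (λ (T , _) → ∀ d → On T d → hid d ≡ false) L
      balanced : All (λ (T , _) → ∀ x → Div3 (signSum hid Z x T)) L
      total    : ∀ d → Y d + Y (rev d) + load L d ≡ 1ℚ

  load-nonneg : ∀ {L} → All (λ (_ , w) → 0ℚ ≤ w) L → ∀ d → 0ℚ ≤ load L d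
  load-nonneg []       d = ℚ.≤-refl
  load-nonneg {(T , w) ∷ L} (p ∷ ps) d = +-nonneg (indicated (on T d)) (load-nonneg ps d)
    where
    indicated : ∀ b → 0ℚ ≤ [ b ] * w
    indicated true  = subst (0ℚ ≤_) (sym (ℚ.*-identityˡ w)) p
    indicated false = subst (0ℚ ≤_) (sym (ℚ.*-zeroˡ w)) ℚ.≤-refl

  load-off : ∀ {L d} → All (λ (T , _) → ¬ On T d) L → load L d ≡ 0ℚ
  load-off [] = refl
  load-off {(T , w) ∷ L} {d} (¬o ∷ ps) = cong₂ _+_ (trans (cong (λ b → [ b ] * w) (on-false T ¬o)) (ℚ.*-zeroˡ w)) (load-off ps)

  module Step (T : Triangle) (w : ℚ) (L : List Weighted) (w≥0 : 0ℚ ≤ w) (L≥0 : All (λ (_ , w) → 0ℚ ≤ w) L)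
    (sorted : All (λ (T′ , _) → size T ℕ.≤ size T′) L) (state : State ((T , w) ∷ L)) where

    open State state
    open Inner T

    I : Dart → Bool
    I = inside T

    T-visible : ∀ d → On T d → hid d ≡ false
    T-visible = All.head visible

    -- By `size-nested` such a `T′` would be smaller than `T`, against the order of treatment.
    later-off : ∀ {d T′} → I d ≡ true → ¬ On T d → size T ℕ.≤ size T′ → ¬ On T′ d
    later-off {T′ = T′} Id off le o = ℕ.≤⇒≯ le (size-nested T T′ o off Id)

    load-inside : ∀ {d} → I d ≡ true → ¬ On T d → load ((T , w) ∷ L) d ≡ 0ℚ
    load-inside Id off = load-off (off ∷ All.map (later-off Id off) sorted)

    -- No triangle still in the list uses this edge, so the treated ones give it its full weight:
    -- `Y d + Y (rev d) = 1`.
    treated : ∀ {d} → I d ≡ true → ¬ On T d → hid d ≡ false → Z (rev d) ≡ neg (Z d)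
    treated {d} Id off vis = trans (Z-Y (rev d) (trans (hid-rev d) vis))
      (trans (cong fract (trans (l (Y d) (Y (rev d))) (cong (_- Y d) complement)))
        (trans (sym (neg-fract (Y d))) (cong neg (sym (Z-Y d vis)))))
      where
      l : ∀ a b → b ≡ (a + b) - a
      l = solve-∀ ringℚ
      complement : Y d + Y (rev d) ≡ 1ℚ
      complement = trans (trans (sym (ℚ.+-identityʳ (Y d + Y (rev d)))) (cong (Y d + Y (rev d) +_) (sym (load-inside Id off)))) (total d)

    treated-rev : ∀ {d} → I d ≡ true → ¬ On T d → hid d ≡ false → Z d ≡ neg (Z (rev d))
    treated-rev {d} Id off vis = trans (cong Z (sym (rev-rev d)))
      (treated (trans (sym (inside-off T off)) Id) (off ∘ On-rev⁻ T) (trans (hid-rev d) vis))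

    y₀ z₀ : ℚ
    y₀ = Y (inner T zero)
    z₀ = fract y₀

    Z-inner : ∀ i → Z (inner T i) ≡ fract (Y (inner T i))
    Z-inner i = Z-Y (inner T i) (T-visible (inner T i) (inner-On i))

    -- The visible faces inside T with values z₀ or 1 - z₀ are closed under crossing edges, hence
    -- they are all of the visible faces inside T.
    like : ℚ → Bool
    like z = (z ≡? z₀) ∨ (z ≡? neg z₀)

    like-neg : ∀ {z z′} → z′ ≡ neg z → like z ≡ true → like z′ ≡ true
    like-neg {z} {z′} e h = [ (λ p → trans (cong ((z′ ≡? z₀) ∨_) (≡?-true (trans e (cong neg (≡?⇒≡ {z} p))))) (𝔹.∨-zeroʳ (z′ ≡? z₀)))
      , (λ p → cong (_∨ (z′ ≡? neg z₀)) (≡?-true (trans e (trans (cong neg (≡?⇒≡ {z} p)) (neg-neg y₀))))) ]′ (∨-true {z ≡? z₀} h)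

    like-cross : ∀ d → ¬ On T d → I d ∧ like (Z d) ≡ I (rev d) ∧ like (Z (rev d))
    like-cross d off = by-cases (I d)
      (λ Id → by-cases (hid d)
        (λ h → cong₂ (λ a z → a ∧ like z) (inside-off T off) (Z-hid d h))
        (λ h → cong₂ _∧_ (inside-off T off) (by-cases (like (Z d))
          (λ e → trans e (sym (like-neg {Z d} (treated Id off h) e)))
          (λ e → trans e (by-cases (like (Z (rev d)))
            (λ e′ → ⊥-elim (true≢false (like-neg {Z (rev d)} (treated-rev Id off h) e′) e)) sym)))))
      (λ ¬Id → trans (cong (_∧ like (Z d)) ¬Id) (sym (cong (_∧ like (Z (rev d))) (trans (sym (inside-off T off)) ¬Id))))

    like-inside : ∀ d → I d ≡ true → like (Z d) ≡ true
    like-inside d Id =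
      [ (λ f → ⊥-elim (true≢false like₀ (f (inner T zero)))) , (λ f → proj₂ (∧-true {I d} (trans (f d) Id))) ]′
      (Enclosed.inside-unique (enclosed T) (λ d → I d ∧ like (Z d))
        (λ d → cong₂ (λ a z → a ∧ like z) (Enclosed.inside-face (enclosed T) d) (Z-face d))
        (λ u r → cong (_∧ like (Z (rootDart u r))) (Enclosed.inside-root (enclosed T) u r))
        like-cross)
      where
      like₀ : I (inner T zero) ∧ like (Z (inner T zero)) ≡ true
      like₀ = cong₂ _∧_ (inner-inside zero) (cong (_∨ (Z (inner T zero) ≡? neg z₀)) (≡?-true (Z-inner zero)))

    inner-cases-Z : ∀ i → Z (inner T i) ≡ z₀ ⊎ Z (inner T i) ≡ neg z₀
    inner-cases-Z i = [ inj₁ ∘ ≡?⇒≡ {Z (inner T i)} , inj₂ ∘ ≡?⇒≡ {Z (inner T i)} ]′ (∨-true {Z (inner T i) ≡? z₀} (like-inside (inner T i) (inner-inside i)))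

    interior : ∀ x d → [ I d ∧ not (hid d) ] * sign x (Z d) ≡
      [ I d ∧ on T d ] * sign x (Z d) + [ (I d ∧ not (on T d)) ∧ not (hid d) ] * sign x (Z d)
    interior x d = by-cases (on T d)
      (λ o → trans (cong (λ b → [ I d ∧ not b ] * s) (T-visible d (on-On T o)))
        (sym (trans (cong (λ b → [ I d ∧ b ] * s + [ (I d ∧ not b) ∧ not (hid d) ] * s) o) (first (I d)))))
      (λ o → sym (trans (cong (λ b → [ I d ∧ b ] * s + [ (I d ∧ not b) ∧ not (hid d) ] * s) o) (second (I d) (not (hid d)))))
      where
      s = sign x (Z d)
      first : ∀ b → [ b ∧ true ] * s + [ (b ∧ false) ∧ not (hid d) ] * s ≡ [ b ∧ true ] * s
      first true  = trans (cong (1ℚ * s +_) (ℚ.*-zeroˡ s)) (ℚ.+-identityʳ (1ℚ * s))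
      first false = trans (cong (0ℚ * s +_) (ℚ.*-zeroˡ s)) (ℚ.+-identityʳ (0ℚ * s))
      second : ∀ b c → [ b ∧ false ] * s + [ (b ∧ true) ∧ c ] * s ≡ [ b ∧ c ] * s
      second true  c = trans (cong (_+ [ c ] * s) (ℚ.*-zeroˡ s)) (ℚ.+-identityˡ ([ c ] * s))
      second false c = trans (cong (_+ 0ℚ * s) (ℚ.*-zeroˡ s)) (ℚ.+-identityˡ (0ℚ * s))

    -- A dart strictly inside `T` is counted together with its reverse, whose value is the negative
    -- one.
    interior-cancel : ∀ x → sum (λ d → [ (I d ∧ not (on T d)) ∧ not (hid d) ] * sign x (Z d)) ≡ 0ℚ
    interior-cancel x = sum-cancel (λ d → [ B d ] * sign x (Z d)) cancel
      where
      B : Dart → Bool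
      B d = (I d ∧ not (on T d)) ∧ not (hid d)
      none : ∀ a b → 0ℚ * a + 0ℚ * b ≡ 0ℚ
      none = solve-∀ ringℚ
      one : ∀ a b → 1ℚ * a + 1ℚ * b ≡ a + b
      one = solve-∀ ringℚ
      B-rev : ∀ d → B (rev d) ≡ B d
      B-rev d = by-cases (on T d)
        (λ o → trans (cong (λ b → (I (rev d) ∧ not b) ∧ not (hid (rev d))) (trans (on-rev T d) o))
          (trans (cong (_∧ not (hid (rev d))) (𝔹.∧-zeroʳ (I (rev d))))
            (sym (trans (cong (λ b → (I d ∧ not b) ∧ not (hid d)) o) (cong (_∧ not (hid d)) (𝔹.∧-zeroʳ (I d)))))))
        (λ o → trans (cong₂ (λ b h → (b ∧ not (on T (rev d))) ∧ not h) (sym (inside-off T (on-off T o))) (hid-rev d))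
          (cong (λ b → (I d ∧ not b) ∧ not (hid d)) (on-rev T d)))
      cancel : ∀ d → [ B d ] * sign x (Z d) + [ B (rev d) ] * sign x (Z (rev d)) ≡ 0ℚ
      cancel d = by-cases (B d)
        (λ e → let io , h = ∧-true {I d ∧ not (on T d)} e
                   Id , o = ∧-true {I d} io
                   off = on-off T (not-true o)
               in trans (cong₂ (λ a b → [ a ] * sign x (Z d) + [ b ] * sign x (Z (rev d))) e (trans (B-rev d) e))
                    (trans (one (sign x (Z d)) (sign x (Z (rev d))))
                      (sign-neg x {Z d} (treated Id off (not-true h)) (treated-rev Id off (not-true h)))))
        (λ e → trans (cong₂ (λ a b → [ a ] * sign x (Z d) + [ b ] * sign x (Z (rev d))) e (trans (B-rev d) e))
                     (none (sign x (Z d)) (sign x (Z (rev d)))))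

    balanced-inner : ∀ x → Div3 (sum (λ i → sign x (Z (inner T i))))
    balanced-inner x = subst Div3 (begin
      signSum hid Z x T ≡⟨ sum-cong (interior x) ⟩
      sum (λ d → [ I d ∧ on T d ] * sign x (Z d) + [ (I d ∧ not (on T d)) ∧ not (hid d) ] * sign x (Z d))
        ≡⟨ sum-+ (λ d → [ I d ∧ on T d ] * sign x (Z d)) (λ d → [ (I d ∧ not (on T d)) ∧ not (hid d) ] * sign x (Z d)) ⟩
      sum (λ d → [ I d ∧ on T d ] * sign x (Z d)) + sum (λ d → [ (I d ∧ not (on T d)) ∧ not (hid d) ] * sign x (Z d))
        ≡⟨ cong₂ _+_ (sum-inner (λ d → sign x (Z d))) (interior-cancel x) ⟩
      sum (λ i → sign x (Z (inner T i))) + 0ℚ ≡⟨ ℚ.+-identityʳ (sum (λ i → sign x (Z (inner T i)))) ⟩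
      sum (λ i → sign x (Z (inner T i))) ∎) (All.head balanced x)
      where open ≡-Reasoning

    abstract
      inner-equal : ∀ i → Z (inner T i) ≡ z₀
      inner-equal = sign-equal y₀ (λ i → Z (inner T i)) (Z-inner zero) inner-cases-Z (balanced-inner z₀)

    Y+w≤1 : ∀ {d} → On T d → Y d + w ≤ 1ℚ
    Y+w≤1 {d} o = subst (Y d + w ≤_) (trans (l (Y d) (Y (rev d)) w (load L d)) (trans (cong (λ b → Y d + Y (rev d) + ([ b ] * w + load L d)) (sym (on-true T o))) (total d)))
        (a≤a+b (+-nonneg (Y-nonneg (rev d)) (load-nonneg L≥0 d)))
      where
      l : ∀ a b c e → (a + c) + (b + e) ≡ a + b + (1ℚ * c + e)
      l = solve-∀ ringℚ

    -- Read off at the first inner side; `increment` shows that the other two give the same.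
    w′ z′ : ℚ
    w′ = round (y₀ + w) - round y₀
    z′ = fract (y₀ + w)

    w′-HalfInteger : HalfInteger w′
    w′-HalfInteger = increment-HalfInteger (Y-nonneg (inner T zero)) w≥0 (Y+w≤1 (inner-On zero))

    increment : ∀ {d} → On T d → I d ≡ true → fract (Y d + w) ≡ z′ × round (Y d + w) ≡ round (Y d) + w′
    increment o Id with inner-complete o Id
    ... | i , refl = same-increment {Y (inner T i)} {y₀} w≥0 (Y+w≤1 o) (Y+w≤1 (inner-On zero)) (trans (sym (Z-inner i)) (inner-equal i))

    hid′ : Dart → Bool
    hid′ d = hid d ∨ (I d ∧ not (on T d))

    -- The whole inside of `T` becomes one merged face, whose value is the common class at the inner
    -- sides once `w` is added; `w` itself is credited only to the inner darts.
    Z′ Y′ : Dart → ℚ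
    Z′ d = if I d then z′ else Z d
    Y′ d = Y d + [ I d ∧ on T d ] * w

    Y′-on : ∀ {d} → I d ∧ on T d ≡ true → Y′ d ≡ Y d + w
    Y′-on {d} e = trans (cong (λ b → Y d + [ b ] * w) e) (cong (Y d +_) (ℚ.*-identityˡ w))

    Y′-off : ∀ {d} → I d ∧ on T d ≡ false → Y′ d ≡ Y d
    Y′-off {d} e = trans (cong (λ b → Y d + [ b ] * w) e) (trans (cong (Y d +_) (ℚ.*-zeroˡ w)) (ℚ.+-identityʳ (Y d)))

    round-Y′ : ∀ d → round (Y′ d) ≡ round (Y d) + [ I d ∧ on T d ] * w′
    round-Y′ d = by-cases (I d ∧ on T d)
      (λ e → let Id , o = ∧-true {I d} e in
        trans (cong round (Y′-on e)) (trans (proj₂ (increment (on-On T o) Id))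
          (sym (trans (cong (λ b → round (Y d) + [ b ] * w′) e) (cong (round (Y d) +_) (ℚ.*-identityˡ w′))))))
      (λ e → trans (cong round (Y′-off e))
          (sym (trans (cong (λ b → round (Y d) + [ b ] * w′) e) (trans (cong (round (Y d) +_) (ℚ.*-zeroˡ w′)) (ℚ.+-identityʳ (round (Y d)))))))

    -- Exactly one dart of an edge of `T` is inside, so a weight given to inner darts reaches each
    -- edge once.
    one-side : ∀ d c → [ I d ∧ on T d ] * c + [ I (rev d) ∧ on T (rev d) ] * c ≡ [ on T d ] * c
    one-side d c = by-cases (on T d)
      (λ o → trans (cong₂ (λ a b → [ I d ∧ a ] * c + [ b ] * c) o (cong₂ _∧_ (inside-on T (on-On T o)) (trans (on-rev T d) o)))
        (trans (flip (I d)) (sym (cong (λ b → [ b ] * c) o))))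
      (λ o → trans (cong₂ (λ a b → [ I d ∧ a ] * c + [ I (rev d) ∧ b ] * c) o (trans (on-rev T d) o))
        (trans (none (I d) (I (rev d))) (sym (cong (λ b → [ b ] * c) o))))
      where
      zero-one : ∀ c → 0ℚ * c + 1ℚ * c ≡ 1ℚ * c
      zero-one = solve-∀ ringℚ
      one-zero : ∀ c → 1ℚ * c + 0ℚ * c ≡ 1ℚ * c
      one-zero = solve-∀ ringℚ
      zero-zero : ∀ c → 0ℚ * c + 0ℚ * c ≡ 0ℚ * c
      zero-zero = solve-∀ ringℚ
      flip : ∀ b → [ b ∧ true ] * c + [ not b ∧ true ] * c ≡ 1ℚ * c
      flip true  = one-zero c
      flip false = zero-one c
      none : ∀ a b → [ a ∧ false ] * c + [ b ∧ false ] * c ≡ 0ℚ * c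
      none a b = trans (cong₂ (λ a b → [ a ] * c + [ b ] * c) (𝔹.∧-zeroʳ a) (𝔹.∧-zeroʳ b)) (zero-zero c)

    Z′-true : ∀ {d} → I d ≡ true → Z′ d ≡ z′
    Z′-true {d} e = cong (λ b → if b then z′ else Z d) e

    Z′-false : ∀ {d} → I d ≡ false → Z′ d ≡ Z d
    Z′-false {d} e = cong (λ b → if b then z′ else Z d) e

    hid′-false : ∀ {d} → I d ≡ false → hid′ d ≡ hid d
    hid′-false {d} e = trans (cong (λ b → hid d ∨ (b ∧ not (on T d))) e) (𝔹.∨-identityʳ (hid d))

    hid′-inside : ∀ {d} → I d ≡ true → I d ∧ not (hid′ d) ≡ I d ∧ on T d
    hid′-inside {d} e = cong (I d ∧_) (by-cases (on T d)
      (λ o → trans (cong₂ (λ h p → not (h ∨ p)) (T-visible d (on-On T o)) (trans (cong (λ b → I d ∧ not b) o) (𝔹.∧-zeroʳ (I d)))) (sym o))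
      (λ o → trans (cong₂ (λ i p → not (hid d ∨ (i ∧ not p))) e o) (trans (cong not (𝔹.∨-zeroʳ (hid d))) (sym o))))

    -- The contribution of the darts inside T changes from signSum hid Z x T, a multiple of
    -- three, to three equal signs.
    signSum-T : ∀ x → Div3 (signSum hid′ Z′ x T)
    signSum-T x = subst Div3 (sym (trans (sum-cong pointwise) (sum-inner (λ _ → sign x z′)))) (Div3-sign x z′)
      where
      pointwise : ∀ d → [ I d ∧ not (hid′ d) ] * sign x (Z′ d) ≡ [ I d ∧ on T d ] * sign x z′
      pointwise d = by-cases (I d)
        (λ e → cong₂ (λ b z → [ b ] * sign x z) (hid′-inside e) (Z′-true e))
        (λ e → trans (trans (cong (λ b → [ b ∧ not (hid′ d) ] * sign x (Z′ d)) e) (ℚ.*-zeroˡ (sign x (Z′ d))))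
                     (sym (trans (cong (λ b → [ b ∧ on T d ] * sign x z′) e) (ℚ.*-zeroˡ (sign x z′)))))

    signSum-disjoint : ∀ x T′ → Disjoint T T′ → signSum hid′ Z′ x T′ ≡ signSum hid Z x T′
    signSum-disjoint x T′ dis = sum-cong λ d → by-cases (I d)
      (λ e → trans (trans (cong (λ b → [ b ∧ not (hid′ d) ] * sign x (Z′ d)) (dis d e)) (ℚ.*-zeroˡ (sign x (Z′ d))))
                   (sym (trans (cong (λ b → [ b ∧ not (hid d) ] * sign x (Z d)) (dis d e)) (ℚ.*-zeroˡ (sign x (Z d))))))
      (λ e → cong₂ (λ h z → [ inside T′ d ∧ not h ] * sign x z) (hid′-false e) (Z′-false e))

    -- Only the contribution of the darts inside `T` is exchanged, and its old and new values are
    -- both divisible by three.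
    signSum-nested : ∀ x T′ → T ⊑ T′ → signSum hid′ Z′ x T′ ≡ signSum hid Z x T′ - signSum hid Z x T + signSum hid′ Z′ x T
    signSum-nested x T′ sub = trans (sum-cong pointwise)
      (trans (sum-+ (λ d → a T′ d - a T d) (a′ T)) (cong (_+ signSum hid′ Z′ x T) (sum-- (a T′) (a T))))
      where
      a a′ : Triangle → Dart → ℚ
      a S d = [ inside S d ∧ not (hid d) ] * sign x (Z d)
      a′ S d = [ inside S d ∧ not (hid′ d) ] * sign x (Z′ d)
      l : ∀ p q → q ≡ p - p + q
      l = solve-∀ ringℚ
      l′ : ∀ p q r → p ≡ p - 0ℚ * q + 0ℚ * r
      l′ = solve-∀ ringℚ
      pointwise : ∀ d → a′ T′ d ≡ a T′ d - a T d + a′ T d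
      pointwise d = by-cases (I d)
        (λ e → trans (l (a T d) (a′ T′ d)) (cong₂ (λ p q → p - a T d + q)
          (cong (λ b → [ b ∧ not (hid d) ] * sign x (Z d)) (trans e (sym (sub d e))))
          (cong (λ b → [ b ∧ not (hid′ d) ] * sign x (Z′ d)) (trans (sub d e) (sym e)))))
        (λ e → trans (cong₂ (λ h z → [ inside T′ d ∧ not h ] * sign x z) (hid′-false e) (Z′-false e))
          (trans (l′ (a T′ d) (sign x (Z d)) (sign x (Z′ d)))
            (cong₂ (λ b c → a T′ d - [ b ∧ not (hid d) ] * sign x (Z d) + [ c ∧ not (hid′ d) ] * sign x (Z′ d)) (sym e) (sym e))))

    ⊑-sym : ∀ T′ → size T ℕ.≤ size T′ → T′ ⊑ T → T ⊑ T′
    ⊑-sym T′ le sub d e = by-cases (inside T′ d) id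
      (λ e′ → ⊥-elim (ℕ.≤⇒≯ le (countF-strict (inside T′) (inside T) sub d e′ e)))

    balanced′ : ∀ {T′} → size T ℕ.≤ size T′ → (∀ x → Div3 (signSum hid Z x T′)) → ∀ x → Div3 (signSum hid′ Z′ x T′)
    balanced′ {T′} le bal x = [ nested ∘ ⊑-sym T′ le , [ (λ dis → subst Div3 (sym (signSum-disjoint x T′ dis)) (bal x)) , nested ]′ ]′ (compare T T′)
      where
      nested : T ⊑ T′ → Div3 (signSum hid′ Z′ x T′)
      nested sub = subst Div3 (sym (signSum-nested x T′ sub))
        (Div3-+ {signSum hid Z x T′ - signSum hid Z x T} {signSum hid′ Z′ x T}
          (Div3-+ {signSum hid Z x T′} { - signSum hid Z x T} (bal x) (Div3-neg {signSum hid Z x T} (All.head balanced x)))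
          (signSum-T x))

    visible′ : ∀ {T′} → size T ℕ.≤ size T′ → (∀ d → On T′ d → hid d ≡ false) → ∀ d → On T′ d → hid′ d ≡ false
    visible′ {T′} le vis d o = by-cases (I d)
      (λ Id → by-cases (on T d)
        (λ t → trans (cong₂ _∨_ (vis d o) (trans (cong (λ b → I d ∧ not b) t) (𝔹.∧-zeroʳ (I d)))) refl)
        (λ t → ⊥-elim (later-off Id (on-off T t) le o)))
      (λ ¬Id → trans (hid′-false ¬Id) (vis d o))

    next-state : State L
    next-state = record
      { hid = hid′ ; Z = Z′ ; Y = Y′
      ; hid-rev = λ d → cong₂ _∨_ (hid-rev d) (by-cases (on T d)
          (λ o → trans (trans (cong (λ b → I (rev d) ∧ not b) (trans (on-rev T d) o)) (𝔹.∧-zeroʳ (I (rev d))))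
                       (sym (trans (cong (λ b → I d ∧ not b) o) (𝔹.∧-zeroʳ (I d)))))
          (λ o → cong₂ (λ a b → a ∧ not b) (sym (inside-off T (on-off T o))) (on-rev T d)))
      ; Z-face = λ d → cong₂ (λ b z → if b then z′ else z) (Enclosed.inside-face (enclosed T) d) (Z-face d)
      ; Z-hid = Z-hid′
      ; Z-Y = Z-Y′
      ; Y-nonneg = λ d → +-nonneg (Y-nonneg d) (indicated (I d ∧ on T d))
      ; visible = All.zipWith (λ { (le , vis) → visible′ le vis }) (sorted , All.tail visible)
      ; balanced = All.zipWith (λ {(T′ , _)} (le , bal) → balanced′ {T′} le bal) (sorted , All.tail balanced)
      ; total = λ d → trans (l (Y d) (Y (rev d)) ([ I d ∧ on T d ] * w) ([ I (rev d) ∧ on T (rev d) ] * w) (load L d))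
          (trans (cong (λ s → Y d + Y (rev d) + (s + load L d)) (one-side d w)) (total d))
      }
      where
      l : ∀ a b p q r → (a + p) + (b + q) + r ≡ a + b + ((p + q) + r)
      l = solve-∀ ringℚ
      indicated : ∀ b → 0ℚ ≤ [ b ] * w
      indicated true  = subst (0ℚ ≤_) (sym (ℚ.*-identityˡ w)) w≥0
      indicated false = subst (0ℚ ≤_) (sym (ℚ.*-zeroˡ w)) ℚ.≤-refl
      Z-hid′ : ∀ d → hid′ d ≡ true → Z′ d ≡ Z′ (rev d)
      Z-hid′ d h = by-cases (on T d)
        (λ o → ⊥-elim (true≢false h (cong₂ _∨_ (T-visible d (on-On T o)) (trans (cong (λ b → I d ∧ not b) o) (𝔹.∧-zeroʳ (I d))))))
        (λ o → let same = inside-off T (on-off T o) in by-cases (I d)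
          (λ Id → trans (Z′-true Id) (sym (Z′-true (trans (sym same) Id))))
          (λ ¬Id → trans (Z′-false ¬Id) (trans (Z-hid d (trans (sym (hid′-false ¬Id)) h)) (sym (Z′-false (trans (sym same) ¬Id))))))
      Z-Y′ : ∀ d → hid′ d ≡ false → Z′ d ≡ fract (Y′ d)
      Z-Y′ d h = by-cases (I d)
        (λ Id → let o : I d ∧ on T d ≡ true
                    o = trans (sym (hid′-inside Id)) (cong₂ (λ a b → a ∧ not b) Id h)
                in trans (Z′-true Id) (trans (sym (proj₁ (increment (on-On T (proj₂ (∧-true {I d} o))) Id))) (cong fract (sym (Y′-on o)))))
        (λ ¬Id → trans (Z′-false ¬Id) (trans (Z-Y d (trans (sym (hid′-false ¬Id)) h)) (cong fract (sym (Y′-off (cong (_∧ on T d) ¬Id))))))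

  data Sorted : List Weighted → Set where
    []  : Sorted []
    _∷_ : ∀ {T w L} → All (λ (T′ , _) → size T ℕ.≤ size T′) L → Sorted L → Sorted ((T , w) ∷ L)

  abstract
    -- Induction on the list: the rounded `Y` on both sides and the new weights still to come fill
    -- every edge. At the end `Y d + Y (rev d) = 1`, and rounding preserves complements.
    rounding : ∀ L → All (λ (_ , w) → 0ℚ ≤ w) L → Sorted L → (state : State L) →
      Σ (List Weighted) λ L′ → All (λ (_ , w) → HalfInteger w) L′ ×
        (∀ d → round (State.Y state d) + round (State.Y state (rev d)) + load L′ d ≡ 1ℚ)
    rounding [] _ _ state = [] , [] , λ d → trans (ℚ.+-identityʳ (round (Y d) + round (Y (rev d))))
        (round-complement′ {Y d} {Y (rev d)} (trans (sym (ℚ.+-identityʳ (Y d + Y (rev d)))) (total d)))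
      where open State state
    rounding ((T , w) ∷ L) (p ∷ ps) (s ∷ ss) state =
      let L′ , halves , eq = rounding L ps ss next-state
      in (T , w′) ∷ L′ , w′-HalfInteger ∷ halves , λ d →
        trans (l (round (Y d)) (round (Y (rev d))) ([ on T d ] * w′) (load L′ d))
          (trans (cong (λ s → round (Y d) + round (Y (rev d)) + s + load L′ d) (sym (one-side d w′)))
            (trans (l′ (round (Y d)) (round (Y (rev d))) ([ I d ∧ on T d ] * w′) ([ I (rev d) ∧ on T (rev d) ] * w′) (load L′ d))
              (trans (cong₂ (λ a b → a + b + load L′ d) (sym (round-Y′ d)) (sym (round-Y′ (rev d)))) (eq d))))
      where
      open Step T w L p ps s state
      open State state
      l : ∀ a b p r → a + b + (p + r) ≡ a + b + p + r
      l = solve-∀ ringℚ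
      l′ : ∀ a b p q r → a + b + (p + q) + r ≡ (a + p) + (b + q) + r
      l′ = solve-∀ ringℚ

-- Lists of weighted triangles

sum-≥ : ∀ {k} (f : Fin k → ℚ) → (∀ i → 0ℚ ≤ f i) → ∀ i → f i ≤ sum f
sum-≥ {suc k} f h zero    = a≤a+b (sum-nonneg (f ∘ suc) (h ∘ suc))
sum-≥ {suc k} f h (suc i) = ℚ.≤-trans (sum-≥ (f ∘ suc) (h ∘ suc) i) (b≤a+b (h zero))

HalfInteger-nonneg : ∀ {a} → HalfInteger a → 0ℚ ≤ a
HalfInteger-nonneg (inj₁ refl)        = ℚ.≤-refl
HalfInteger-nonneg (inj₂ (inj₁ refl)) = ℚ.nonNegative⁻¹ 1ℚ
HalfInteger-nonneg (inj₂ (inj₂ refl)) = ℚ.nonNegative⁻¹ ½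

HalfInteger-+ : ∀ {a b} → HalfInteger a → HalfInteger b → a + b ≤ 1ℚ → HalfInteger (a + b)
HalfInteger-+ {a} {b} (inj₁ refl) hb _ = subst HalfInteger (sym (ℚ.+-identityˡ b)) hb
HalfInteger-+ {a} {b} ha (inj₁ refl) _ = subst HalfInteger (sym (ℚ.+-identityʳ a)) ha
HalfInteger-+ (inj₂ (inj₂ refl)) (inj₂ (inj₂ refl)) _ = inj₂ (inj₁ refl)
HalfInteger-+ (inj₂ (inj₁ refl)) (inj₂ (inj₁ refl)) le = ⊥-elim (1ℚ≢0ℚ (no-room (ℚ.nonNegative⁻¹ 1ℚ) le))
HalfInteger-+ (inj₂ (inj₁ refl)) (inj₂ (inj₂ refl)) le with no-room (ℚ.nonNegative⁻¹ ½) le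
... | ()
HalfInteger-+ (inj₂ (inj₂ refl)) (inj₂ (inj₁ refl)) le with no-room (ℚ.nonNegative⁻¹ ½) (subst (_≤ 1ℚ) (ℚ.+-comm ½ 1ℚ) le)
... | ()

tabulate-++ : ∀ {k} {A : Set} → (Fin k → List A) → List A
tabulate-++ {zero}  f = []
tabulate-++ {suc k} f = f zero ++ tabulate-++ (f ∘ suc)

All-tabulate-++ : ∀ {k} {A : Set} {P : A → Set} (f : Fin k → List A) → (∀ i → All P (f i)) → All P (tabulate-++ f)
All-tabulate-++ {zero}  f h = []
All-tabulate-++ {suc k} f h = All.++⁺ (h zero) (All-tabulate-++ (f ∘ suc) (h ∘ suc))

increasing-corners : ∀ {n} (k : Fin 3 → Fin n) → toℕ (k zero) ℕ.< toℕ (k (suc zero)) → toℕ (k (suc zero)) ℕ.< toℕ (k (suc (suc zero))) →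
  ∀ i j → toℕ (k i) ℕ.< toℕ (k j) → toℕ i ℕ.< toℕ j
increasing-corners k p q i j h with ℕ.<-cmp (toℕ i) (toℕ j)
... | tri< i<j _ _ = i<j
... | tri≈ _ i≡j _ = ⊥-elim (ℕ.<-irrefl (cong (toℕ ∘ k) (Fin.toℕ-injective i≡j)) h)
... | tri> _ _ j<i = ⊥-elim (ℕ.<-asym h (up j i j<i))
  where
  up : ∀ i j → toℕ i ℕ.< toℕ j → toℕ (k i) ℕ.< toℕ (k j)
  up zero       (suc zero)       _ = p
  up zero       (suc (suc zero)) _ = ℕ.<-trans p q
  up (suc zero) (suc (suc zero)) _ = q
  up (suc zero) (suc zero) (s≤s ())
  up (suc (suc zero)) (suc zero) (s≤s ())
  up (suc (suc zero)) (suc (suc zero)) (s≤s (s≤s ()))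

increasing-indices : ∀ (i j l : Fin 3) → toℕ i ℕ.< toℕ j → toℕ j ℕ.< toℕ l → i ≡ zero × j ≡ suc zero × l ≡ suc (suc zero)
increasing-indices zero (suc zero) (suc (suc zero)) _ _ = refl , refl , refl
increasing-indices zero (suc zero) (suc zero) _ (s≤s ())
increasing-indices zero (suc (suc zero)) (suc zero) _ (s≤s ())
increasing-indices zero (suc (suc zero)) (suc (suc zero)) _ (s≤s (s≤s ()))
increasing-indices (suc zero) (suc zero) l (s≤s ()) _
increasing-indices (suc zero) (suc (suc zero)) (suc zero) _ (s≤s ())
increasing-indices (suc zero) (suc (suc zero)) (suc (suc zero)) _ (s≤s (s≤s ()))
increasing-indices (suc (suc zero)) (suc zero) l (s≤s ()) _
increasing-indices (suc (suc zero)) (suc (suc zero)) l (s≤s (s≤s ())) _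

after-thrice : ∀ i j → i ≡ j ⊎ j ≡ after i ⊎ j ≡ after (after i)
after-thrice i j with after-cases i j
... | inj₁ e = inj₁ e
... | inj₂ (inj₁ e) = inj₂ (inj₁ e)
... | inj₂ (inj₂ refl) = inj₂ (inj₂ (sym (thrice j)))

-- Weight functions of lists and loads of edges

module Weights {n : ℕ} {G : SimpleGraph n} (R : RotationSystem G)
  (euler : 2 ℕ.* (vertexCount R ℕ.+ faceCount R) ≡ m R ℕ.+ 4 ℕ.* nontrivialComponents G) where

  open Embedding R euler
  open Regions R euler
  open Nesting R euler
  open Rounding R euler
  open Triangle

  abstract
    has : Triangle → Fin n → Bool
    has T u = does (corner? T u)

    has-true : ∀ T {u} → Corner T u → has T u ≡ true
    has-true T {u} = dec-true (corner? T u)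

    has-Corner : ∀ T {u} → has T u ≡ true → Corner T u
    has-Corner T {u} = does-true (corner? T u)

  -- Membership of each vertex separately is symmetric; for three distinct vertices it says that
  -- they are the corners.
  spans : Triangle → Fin n → Fin n → Fin n → Bool
  spans T u v x = has T u ∧ (has T v ∧ has T x)

  spans-swap₁₂ : ∀ T u v x → spans T u v x ≡ spans T v u x
  spans-swap₁₂ T u v x = trans (sym (𝔹.∧-assoc (has T u) (has T v) (has T x)))
    (trans (cong (_∧ has T x) (𝔹.∧-comm (has T u) (has T v))) (𝔹.∧-assoc (has T v) (has T u) (has T x)))

  spans-swap₂₃ : ∀ T u v x → spans T u v x ≡ spans T u x v
  spans-swap₂₃ T u v x = cong (has T u ∧_) (𝔹.∧-comm (has T v) (has T x))

  weight : List Weighted → Fin n → Fin n → Fin n → ℚ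
  weight []            u v x = 0ℚ
  weight ((T , w) ∷ L) u v x = [ spans T u v x ] * w + weight L u v x

  weight-swap₁₂ : ∀ L u v x → weight L u v x ≡ weight L v u x
  weight-swap₁₂ []            u v x = refl
  weight-swap₁₂ ((T , w) ∷ L) u v x = cong₂ (λ b y → [ b ] * w + y) (spans-swap₁₂ T u v x) (weight-swap₁₂ L u v x)

  weight-swap₂₃ : ∀ L u v x → weight L u v x ≡ weight L u x v
  weight-swap₂₃ []            u v x = refl
  weight-swap₂₃ ((T , w) ∷ L) u v x = cong₂ (λ b y → [ b ] * w + y) (spans-swap₂₃ T u v x) (weight-swap₂₃ L u v x)

  weight-++ : ∀ L L′ u v x → weight (L ++ L′) u v x ≡ weight L u v x + weight L′ u v x
  weight-++ []            L′ u v x = sym (ℚ.+-identityˡ (weight L′ u v x))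
  weight-++ ((T , w) ∷ L) L′ u v x = trans (cong ([ spans T u v x ] * w +_) (weight-++ L L′ u v x))
    (sym (ℚ.+-assoc ([ spans T u v x ] * w) (weight L u v x) (weight L′ u v x)))

  weight-tabulate : ∀ {k} (f : Fin k → List Weighted) u v x → weight (tabulate-++ f) u v x ≡ sum (λ i → weight (f i) u v x)
  weight-tabulate {zero}  f u v x = refl
  weight-tabulate {suc k} f u v x = trans (weight-++ (f zero) (tabulate-++ (f ∘ suc)) u v x)
    (cong (weight (f zero) u v x +_) (weight-tabulate (f ∘ suc) u v x))

  adj-sym′ : ∀ {u v} → adj G u v ≡ true → adj G v u ≡ true
  adj-sym′ {u} {v} e = trans (adj-sym G v u) e

  common : Dart → Fin n → Bool
  common d x = adj G (org d) x ∧ adj G (org (rev d)) x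

  common-rev : ∀ d x → common (rev d) x ≡ common d x
  common-rev d x = trans (cong (λ e → adj G (org (rev d)) x ∧ adj G (org e) x) (rev-rev d)) (𝔹.∧-comm (adj G (org (rev d)) x) (adj G (org d) x))

  completes : Triangle → Dart → Fin n → Bool
  completes T d x = common d x ∧ spans T (org d) (org (rev d)) x

  completes-rev : ∀ T d x → completes T (rev d) x ≡ completes T d x
  completes-rev T d x = cong₂ _∧_ (common-rev d x)
    (trans (cong (λ e → spans T (org (rev d)) (org e) x) (rev-rev d)) (spans-swap₁₂ T (org (rev d)) (org d) x))

  completes-side : ∀ T i → sum (λ x → [ completes T (side T i) x ]) ≡ 1ℚ
  completes-side T i = trans (sum-single (λ x → [ completes T (side T i) x ]) c other) (cong [_] this)
    where
    c : Fin n
    c = corner T (after (after i))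
    u v : Fin n
    u = corner T i
    v = org (rev (side T i))
    thrice′ : after (after (after i)) ≡ i
    thrice′ = thrice i
    this : completes T (side T i) c ≡ true
    this = cong₂ _∧_
      (cong₂ _∧_
        (adj-sym′ (subst (λ y → adj G c y ≡ true) (trans (link T (after (after i))) (cong (corner T) thrice′)) (dart-edge R (side T (after (after i))))))
        (subst₂ (λ y z → adj G y z ≡ true) (sym (link T i)) (link T (after i)) (dart-edge R (side T (after i)))))
      (cong₂ _∧_ (has-true T (i , refl)) (cong₂ _∧_ (has-true T (after i , link T i)) (has-true T (after (after i) , refl))))
    other : ∀ x → x ≢ c → [ completes T (side T i) x ] ≡ 0ℚ
    other x x≢c = by-cases (completes T (side T i) x) contra (cong [_])
      where
      contra : completes T (side T i) x ≡ true → [ completes T (side T i) x ] ≡ 0ℚ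
      contra e =
        let near , sp = ∧-true {common (side T i) x} e
            ux , vx = ∧-true {adj G u x} near
            _ , sp′ = ∧-true {has T u} sp
            _ , hx = ∧-true {has T v} sp′
            j , xj = has-Corner T hx
            at : ∀ {k} → j ≡ k → x ≡ corner T k
            at = λ jk → trans xj (cong (corner T) jk)
        in ⊥-elim ([ (λ ij → adj-distinct ux (sym (at (sym ij))))
                   , [ (λ ja → adj-distinct vx (trans (link T i) (sym (at ja))))
                     , (λ ja → x≢c (at ja)) ]′ ]′ (after-thrice i j))

  -- An edge on `T` is completed by the opposite corner alone. Conversely, if some vertex completes
  -- `d`, both ends of `d` are corners, and a chord is a side.
  completes-count : ∀ T d → sum (λ x → [ completes T d x ]) ≡ [ on T d ]
  completes-count T d = by-cases (on T d) (λ o → trans (onT (on-On T o)) (cong [_] (sym o)))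
    (λ o → trans (sum-zero (λ x → [ completes T d x ]) (λ x → by-cases (completes T d x)
      (λ e → let _ , sp = ∧-true {common d x} e
                 hu , sp′ = ∧-true {has T (org d)} sp
                 hv , _ = ∧-true {has T (org (rev d))} sp′
                 i , ui = has-Corner T hu
                 j , vj = has-Corner T hv
             in ⊥-elim (on-off T o (chord-On T d i j ui vj)))
      (cong [_]))) (cong [_] (sym o)))
    where
    onT : On T d → sum (λ x → [ completes T d x ]) ≡ 1ℚ
    onT (i , inj₁ e) = trans (cong (λ d → sum (λ x → [ completes T d x ])) e) (completes-side T i)
    onT (i , inj₂ e) = trans (sum-cong (λ x → cong [_] (sym (completes-rev T d x))))
      (trans (cong (λ d → sum (λ x → [ completes T d x ])) e) (completes-side T i))

  -- Translates the edge condition of a decomposition into the load of a list.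
  weight-load : ∀ L d → sum (λ x → if common d x then weight L (org d) (org (rev d)) x else 0ℚ) ≡ load L d
  weight-load [] d = sum-zero (λ x → if common d x then 0ℚ else 0ℚ) (λ x → constant (common d x))
    where
    constant : ∀ b → (if b then 0ℚ else 0ℚ) ≡ 0ℚ
    constant true  = refl
    constant false = refl
  weight-load ((T , w) ∷ L) d = begin
    sum (λ x → if common d x then [ s x ] * w + r x else 0ℚ)
      ≡⟨ sum-cong (λ x → split (common d x) (s x) (r x)) ⟩
    sum (λ x → [ completes T d x ] * w + (if common d x then r x else 0ℚ))
      ≡⟨ sum-+ (λ x → [ completes T d x ] * w) (λ x → if common d x then r x else 0ℚ) ⟩
    sum (λ x → [ completes T d x ] * w) + sum (λ x → if common d x then r x else 0ℚ)
      ≡⟨ cong₂ _+_ (trans (sum-*ʳ (λ x → [ completes T d x ]) w) (cong (_* w) (completes-count T d))) (weight-load L d) ⟩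
    [ on T d ] * w + load L d ∎
    where
    open ≡-Reasoning
    s : Fin n → Bool
    s x = spans T (org d) (org (rev d)) x
    r : Fin n → ℚ
    r x = weight L (org d) (org (rev d)) x
    split : ∀ b c r → (if b then [ c ] * w + r else 0ℚ) ≡ [ b ∧ c ] * w + (if b then r else 0ℚ)
    split true  c r = refl
    split false c r = sym (trans (ℚ.+-identityʳ (0ℚ * w)) (ℚ.*-zeroˡ w))

  insert : Weighted → List Weighted → List Weighted
  insert t []      = t ∷ []
  insert t (s ∷ L) with size (proj₁ t) ℕ.≤? size (proj₁ s)
  ... | yes _ = t ∷ s ∷ L
  ... | no _  = s ∷ insert t L

  sort : List Weighted → List Weighted
  sort []      = []
  sort (t ∷ L) = insert t (sort L)

  module _ {P : Weighted → Set} where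

    All-insert : ∀ {t} L → P t → All P L → All P (insert t L)
    All-insert [] p [] = p ∷ []
    All-insert {t} (s ∷ L) p (q ∷ qs) with size (proj₁ t) ℕ.≤? size (proj₁ s)
    ... | yes _ = p ∷ q ∷ qs
    ... | no _  = q ∷ All-insert L p qs

    All-sort : ∀ L → All P L → All P (sort L)
    All-sort []      []       = []
    All-sort (t ∷ L) (p ∷ ps) = All-insert (sort L) p (All-sort L ps)

  load-insert : ∀ t L d → load (insert t L) d ≡ load (t ∷ L) d
  load-insert t [] d = refl
  load-insert (T , w) ((T′ , w′) ∷ L) d with size T ℕ.≤? size T′
  ... | yes _ = refl
  ... | no _  = trans (cong ([ on T′ d ] * w′ +_) (load-insert (T , w) L d)) (l ([ on T′ d ] * w′) ([ on T d ] * w) (load L d))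
    where
    l : ∀ a b c → a + (b + c) ≡ b + (a + c)
    l = solve-∀ ringℚ

  load-sort : ∀ L d → load (sort L) d ≡ load L d
  load-sort []            d = refl
  load-sort ((T , w) ∷ L) d = trans (load-insert (T , w) (sort L) d) (cong ([ on T d ] * w +_) (load-sort L d))

  insert-Sorted : ∀ t {L} → Sorted L → Sorted (insert t L)
  insert-Sorted t [] = [] ∷ []
  insert-Sorted (T , w) {(T′ , w′) ∷ L} (h ∷ hs) with size T ℕ.≤? size T′
  ... | yes le = (le ∷ All.map (ℕ.≤-trans le) h) ∷ h ∷ hs
  ... | no ¬le = All-insert L (ℕ.<⇒≤ (ℕ.≰⇒> ¬le)) h ∷ insert-Sorted (T , w) hs

  sort-Sorted : ∀ L → Sorted (sort L)
  sort-Sorted []      = []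
  sort-Sorted (t ∷ L) = insert-Sorted t (sort-Sorted L)

  -- With all values 0 the counts vanish, because 0 is its own negative.
  initial-state : ∀ {L} → (∀ d → load L d ≡ 1ℚ) → State L
  initial-state {L} h = record
    { hid = λ _ → false ; Z = λ _ → 0ℚ ; Y = λ _ → 0ℚ
    ; hid-rev = λ _ → refl ; Z-face = λ _ → refl ; Z-hid = λ _ _ → refl ; Z-Y = λ _ _ → refl
    ; Y-nonneg = λ _ → ℚ.≤-refl
    ; visible = All.universal (λ _ _ _ → refl) L
    ; balanced = All.universal (λ { (T , _) x → subst Div3 (sym (no-sign x T)) Div3-0 }) L
    ; total = λ d → trans (ℚ.+-identityˡ (load L d)) (h d)
    }
    where
    no-sign : ∀ x T → signSum (λ _ → false) (λ _ → 0ℚ) x T ≡ 0ℚ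
    no-sign x T = sum-zero (λ d → [ inside T d ∧ true ] * sign x 0ℚ)
      (λ d → trans (cong ([ inside T d ∧ true ] *_) (ℚ.+-inverseʳ [ 0ℚ ≡? x ])) (ℚ.*-zeroʳ [ inside T d ∧ true ]))

  -- Several entries may span the same triple, so their weights add up; the bound 1 keeps each
  -- partial sum in the allowed set.
  weight-HalfInteger : ∀ {L} → All (λ (_ , w) → HalfInteger w) L → ∀ u v x → weight L u v x ≤ 1ℚ → HalfInteger (weight L u v x)

  weight-nonneg : ∀ {L} → All (λ (_ , w) → HalfInteger w) L → ∀ u v x → 0ℚ ≤ weight L u v x

  indicated : ∀ b {w} → HalfInteger w → HalfInteger ([ b ] * w)
  indicated true  {w} h = subst HalfInteger (sym (ℚ.*-identityˡ w)) h
  indicated false {w} h = inj₁ (ℚ.*-zeroˡ w)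

  weight-HalfInteger [] u v x le = inj₁ refl
  weight-HalfInteger {(T , w) ∷ L} (h ∷ hs) u v x le = HalfInteger-+ hw
      (weight-HalfInteger hs u v x (ℚ.≤-trans (b≤a+b (HalfInteger-nonneg hw)) le)) le
    where
    hw : HalfInteger ([ spans T u v x ] * w)
    hw = indicated (spans T u v x) h

  weight-nonneg [] u v x = ℚ.≤-refl
  weight-nonneg {(T , w) ∷ L} (h ∷ hs) u v x = +-nonneg (HalfInteger-nonneg (indicated (spans T u v x) h)) (weight-nonneg hs u v x)

  halfIntegral : ∀ {L} → All (λ (_ , w) → HalfInteger w) L → (∀ d → load L d ≡ 1ℚ) →
    Σ (RationalK3Decomposition G) λ D → ∀ a b c → IsTriangle G a b c → HalfInteger (w D a b c)
  halfIntegral {L} halves full = D , λ a b c (ab , bc , ac) → weight-HalfInteger halves a b c (bounded a b c ab bc ac)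
    where
    term : Fin n → Fin n → Fin n → ℚ
    term u v x = if adj G u x ∧ adj G v x then weight L u v x else 0ℚ
    edge-sum : ∀ u v → adj G u v ≡ true → sum (term u v) ≡ 1ℚ
    edge-sum u v uv with dart-surj R u v uv
    ... | d , refl , refl = trans (weight-load L d) (full d)
    term-nonneg : ∀ u v x → 0ℚ ≤ term u v x
    term-nonneg u v x = choose (adj G u x ∧ adj G v x)
      where
      choose : ∀ b → 0ℚ ≤ (if b then weight L u v x else 0ℚ)
      choose true  = weight-nonneg halves u v x
      choose false = ℚ.≤-refl
    -- The weight of a triangle is one of the nonnegative terms adding up to 1 on its edge.
    bounded : ∀ a b c → adj G a b ≡ true → adj G b c ≡ true → adj G a c ≡ true → weight L a b c ≤ 1ℚ
    bounded a b c ab bc ac = subst₂ _≤_ (cong (λ t → if t then weight L a b c else 0ℚ) (cong₂ _∧_ ac bc)) (edge-sum a b ab)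
      (sum-≥ (term a b) (term-nonneg a b) c)
    D : RationalK3Decomposition G
    D = record
      { w = weight L ; w-swap₁₂ = weight-swap₁₂ L ; w-swap₂₃ = weight-swap₂₃ L
      ; w-nonneg = λ a b c _ → weight-nonneg halves a b c ; w-edge = edge-sum }

  -- The list of a given decomposition

  module Triangles (D : RationalK3Decomposition G) where

    W : Fin n → Fin n → Fin n → ℚ
    W = w D

    increasing : Fin n → Fin n → Fin n → Bool
    increasing a b c = (toℕ a ℕ.<ᵇ toℕ b) ∧ (toℕ b ℕ.<ᵇ toℕ c)

    triangular : Fin n → Fin n → Fin n → Bool
    triangular a b c = adj G a b ∧ (adj G b c ∧ adj G a c)

    record Cornered (a b c : Fin n) : Set where
      field
        tri : Triangle
        c₀  : corner tri zero ≡ a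
        c₁  : corner tri (suc zero) ≡ b
        c₂  : corner tri (suc (suc zero)) ≡ c

    open Cornered

    abstract
      cornered : ∀ {a b c} → triangular a b c ≡ true → Cornered a b c
      cornered {a} {b} {c} e =
        let ab , e′ = ∧-true {adj G a b} e
            bc , ac = ∧-true {adj G b c} e′
        in build (dart-surj R a b ab) (dart-surj R b c bc) (dart-surj R c a (adj-sym′ ac))
        where
        build : (∃ λ d → org d ≡ a × org (rev d) ≡ b) → (∃ λ d → org d ≡ b × org (rev d) ≡ c) →
          (∃ λ d → org d ≡ c × org (rev d) ≡ a) → Cornered a b c
        build (p , p₀ , p₁) (q , q₀ , q₁) (r , r₀ , r₁) = record
          { tri = record
            { side = λ { zero → p ; (suc zero) → q ; (suc (suc zero)) → r }
            ; link = λ { zero → trans p₁ (sym q₀) ; (suc zero) → trans q₁ (sym r₀) ; (suc (suc zero)) → trans r₁ (sym p₀) } }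
          ; c₀ = p₀ ; c₁ = q₀ ; c₂ = r₀ }

    -- Increasing triples only, so that each triangle is listed once.
    cell : Fin n → Fin n → Fin n → List Weighted
    cell a b c = cons-if (increasing a b c ∧ triangular a b c)
      (λ e → tri (cornered (proj₂ (∧-true {increasing a b c} e))) , W a b c) []

    all-cells : List Weighted
    all-cells = tabulate-++ λ a → tabulate-++ λ b → tabulate-++ λ c → cell a b c

    cell-nonneg : ∀ a b c → All (λ (_ , w) → 0ℚ ≤ w) (cell a b c)
    cell-nonneg a b c = go (increasing a b c ∧ triangular a b c) _ λ e →
      let tr = proj₂ (∧-true {increasing a b c} e)
          ab , e′ = ∧-true {adj G a b} tr
          bc , ac = ∧-true {adj G b c} e′
      in w-nonneg D a b c (ab , bc , ac)
      where
      go : ∀ t (x : t ≡ true → Weighted) → (∀ e → 0ℚ ≤ proj₂ (x e)) → All (λ (_ , w) → 0ℚ ≤ w) (cons-if t x [])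
      go true  x h = h refl ∷ []
      go false x h = []

    all-cells-nonneg : All (λ (_ , w) → 0ℚ ≤ w) all-cells
    all-cells-nonneg = All-tabulate-++ _ λ a → All-tabulate-++ _ λ b → All-tabulate-++ _ λ c → cell-nonneg a b c

    cons-weight : ∀ t (x : t ≡ true → Weighted) u v y {r} →
      (∀ e → [ spans (proj₁ (x e)) u v y ] * proj₂ (x e) ≡ r) → (t ≡ false → r ≡ 0ℚ) → weight (cons-if t x []) u v y ≡ r
    cons-weight true  x u v y h _ = trans (ℚ.+-identityʳ _) (h refl)
    cons-weight false x u v y _ h = sym (h refl)

    module _ {u v x : Fin n} (u<v : toℕ u ℕ.< toℕ v) (v<x : toℕ v ℕ.< toℕ x) where

      -- As the corners increase with their indices, the indices of `u`, `v`, `x` increase too and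
      -- can only be 0, 1, 2.
      spans-increasing : ∀ {a b c} (C : Cornered a b c) → increasing a b c ≡ true → spans (tri C) u v x ≡ true → a ≡ u × b ≡ v × c ≡ x
      spans-increasing {a} {b} {c} C inc sp =
        let a<b , b<c = ∧-true {toℕ a ℕ.<ᵇ toℕ b} inc
            hu , sp′ = ∧-true {has (tri C) u} sp
            hv , hx = ∧-true {has (tri C) v} sp′
            i , ui = has-Corner (tri C) hu
            j , vj = has-Corner (tri C) hv
            l , xl = has-Corner (tri C) hx
            below = increasing-corners (corner (tri C))
              (subst₂ (λ p q → toℕ p ℕ.< toℕ q) (sym (c₀ C)) (sym (c₁ C)) (ℕ.<ᵇ⇒< _ _ (true⇒T a<b)))
              (subst₂ (λ p q → toℕ p ℕ.< toℕ q) (sym (c₁ C)) (sym (c₂ C)) (ℕ.<ᵇ⇒< _ _ (true⇒T b<c)))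
            i0 , j1 , l2 = increasing-indices i j l
              (below i j (subst₂ (λ p q → toℕ p ℕ.< toℕ q) ui vj u<v)) (below j l (subst₂ (λ p q → toℕ p ℕ.< toℕ q) vj xl v<x))
        in trans (sym (c₀ C)) (trans (cong (corner (tri C)) (sym i0)) (sym ui)) ,
           trans (sym (c₁ C)) (trans (cong (corner (tri C)) (sym j1)) (sym vj)) ,
           trans (sym (c₂ C)) (trans (cong (corner (tri C)) (sym l2)) (sym xl))

      cell-other : ∀ a b c → ¬ (a ≡ u × b ≡ v × c ≡ x) → weight (cell a b c) u v x ≡ 0ℚ
      cell-other a b c ne = cons-weight (increasing a b c ∧ triangular a b c) _ u v x
        (λ e → let inc , tr = ∧-true {increasing a b c} e in
          by-cases (spans (tri (cornered tr)) u v x)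
            (λ sp → ⊥-elim (ne (spans-increasing (cornered tr) inc sp)))
            (λ sp → trans (cong (λ t → [ t ] * W a b c) sp) (ℚ.*-zeroˡ (W a b c))))
        (λ _ → refl)

      cell-this : triangular u v x ≡ true → weight (cell u v x) u v x ≡ W u v x
      cell-this tr = cons-weight (increasing u v x ∧ triangular u v x) _ u v x
        (λ e → let C = cornered (proj₂ (∧-true {increasing u v x} e)) in
          trans (cong (λ t → [ t ] * W u v x) (cong₂ _∧_ (has-true (tri C) (zero , sym (c₀ C)))
            (cong₂ _∧_ (has-true (tri C) (suc zero , sym (c₁ C))) (has-true (tri C) (suc (suc zero) , sym (c₂ C))))))
            (ℚ.*-identityˡ (W u v x)))
        (λ e → ⊥-elim (true≢false (cong₂ _∧_ (cong₂ _∧_ (<ᵇ-true u<v) (<ᵇ-true v<x)) tr) e))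

      weight-increasing : triangular u v x ≡ true → weight all-cells u v x ≡ W u v x
      weight-increasing tr = begin
        weight all-cells u v x
          ≡⟨ weight-tabulate (λ a → tabulate-++ λ b → tabulate-++ λ c → cell a b c) u v x ⟩
        sum (λ a → weight (tabulate-++ λ b → tabulate-++ λ c → cell a b c) u v x)
          ≡⟨ sum-cong (λ a → weight-tabulate (λ b → tabulate-++ λ c → cell a b c) u v x) ⟩
        sum (λ a → sum λ b → weight (tabulate-++ λ c → cell a b c) u v x)
          ≡⟨ sum-cong (λ a → sum-cong λ b → weight-tabulate (λ c → cell a b c) u v x) ⟩
        sum (λ a → sum λ b → sum λ c → S a b c)
          ≡⟨ sum-single (λ a → sum λ b → sum λ c → S a b c) u (λ a a≢u → sum-zero (λ b → sum (S a b)) λ b → sum-zero (S a b) λ c →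
               cell-other a b c (a≢u ∘ proj₁)) ⟩
        sum (λ b → sum λ c → S u b c)
          ≡⟨ sum-single (λ b → sum λ c → S u b c) v (λ b b≢v → sum-zero (S u b) λ c → cell-other u b c (b≢v ∘ proj₁ ∘ proj₂)) ⟩
        sum (λ c → S u v c)
          ≡⟨ sum-single (S u v) x (λ c c≢x → cell-other u v c (c≢x ∘ proj₂ ∘ proj₂)) ⟩
        S u v x ≡⟨ cell-this tr ⟩
        W u v x ∎
        where
        open ≡-Reasoning
        S : Fin n → Fin n → Fin n → ℚ
        S a b c = weight (cell a b c) u v x

    Correct : Fin n → Fin n → Fin n → Set
    Correct u v x = weight all-cells u v x ≡ W u v x

    correct-swap₁₂ : ∀ {u v x} → Correct v u x → Correct u v x
    correct-swap₁₂ {u} {v} {x} e = trans (weight-swap₁₂ all-cells u v x) (trans e (w-swap₁₂ D v u x))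

    correct-swap₂₃ : ∀ {u v x} → Correct u x v → Correct u v x
    correct-swap₂₃ {u} {v} {x} e = trans (weight-swap₂₃ all-cells u v x) (trans e (w-swap₂₃ D u x v))

    triangular-intro : ∀ {u v x} → IsTriangle G u v x → triangular u v x ≡ true
    triangular-intro (uv , vx , ux) = cong₂ _∧_ uv (cong₂ _∧_ vx ux)

    compare-vertices : ∀ {u v} → adj G u v ≡ true → toℕ u ℕ.< toℕ v ⊎ toℕ v ℕ.< toℕ u
    compare-vertices {u} {v} e with ℕ.<-cmp (toℕ u) (toℕ v)
    ... | tri< lt _ _ = inj₁ lt
    ... | tri≈ _ eq _ = ⊥-elim (adj-distinct e (Fin.toℕ-injective eq))
    ... | tri> _ _ gt = inj₂ gt

    correct-ordered : ∀ {u v x} → IsTriangle G u v x → toℕ u ℕ.< toℕ v → Correct u v x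
    correct-ordered {u} {v} {x} t@(uv , vx , ux) u<v =
      [ (λ v<x → weight-increasing u<v v<x (triangular-intro t))
      , (λ x<v → correct-swap₂₃ ([ (λ u<x → weight-increasing u<x x<v (triangular-intro (ux , adj-sym′ vx , uv)))
                                 , (λ x<u → correct-swap₁₂ (weight-increasing x<u u<v (triangular-intro (adj-sym′ ux , uv , adj-sym′ vx)))) ]′
                                 (compare-vertices ux))) ]′ (compare-vertices vx)

    -- Both weight functions are symmetric, so the three vertices may be sorted.
    correct : ∀ {u v x} → IsTriangle G u v x → Correct u v x
    correct t@(uv , vx , ux) = [ correct-ordered t , (λ v<u → correct-swap₁₂ (correct-ordered (adj-sym′ uv , ux , vx) v<u)) ]′ (compare-vertices uv)

    all-cells-load : ∀ d → load all-cells d ≡ 1ℚ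
    all-cells-load d = trans (sym (weight-load all-cells d)) (trans (sum-cong same) (w-edge D (org d) (org (rev d)) (dart-edge R d)))
      where
      same : ∀ x → (if common d x then weight all-cells (org d) (org (rev d)) x else 0ℚ) ≡ (if common d x then W (org d) (org (rev d)) x else 0ℚ)
      same x = by-cases (common d x)
        (λ e → let ux , vx = ∧-true {adj G (org d) x} e in cong (λ y → if common d x then y else 0ℚ) (correct (dart-edge R d , vx , ux)))
        (λ e → trans (cong (λ t → if t then weight all-cells (org d) (org (rev d)) x else 0ℚ) e)
                     (sym (cong (λ t → if t then W (org d) (org (rev d)) x else 0ℚ) e)))

    half-integral-decomposition : Σ (RationalK3Decomposition G) λ D → ∀ a b c → IsTriangle G a b c → HalfInteger (w D a b c)
    half-integral-decomposition =
      let L = sort all-cells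
          full = λ d → trans (load-sort all-cells d) (all-cells-load d)
          L′ , halves , eq = rounding L (All-sort all-cells all-cells-nonneg) (sort-Sorted all-cells) (initial-state full)
      in halfIntegral halves (λ d → trans (sym (ℚ.+-identityˡ (load L′ d))) (eq d))

theorem7 : {n : ℕ} (G : SimpleGraph n) → Planar G → RationallyK3Decomposable G →
  Σ (RationalK3Decomposition G) λ D →
    ∀ a b c → IsTriangle G a b c →
      w D a b c ≡ 0ℚ ⊎ w D a b c ≡ 1ℚ ⊎ w D a b c ≡ ½
theorem7 G (R , euler) D = Weights.Triangles.half-integral-decomposition R euler D
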